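{- For all integers $n\geq 2$, $$\sum_{\lambda\vdash n}(-1)^{v(\lambda)}I_\lambda^2=0.$$
   Context: A shape $\lambda$ is the Ferrers diagram of an integer partition; $\lambda\vdash n$ means it has $n$ squares. A standard Young tableau (SYT) on an $n$-shape is a filling with $1,\ldots,n$, each once, increasing along rows and down columns. The sign $\mathrm{sgn}(T)$ of a tableau is the sign of the word obtained by reading its entries row by row, left to right, top to bottom; the sign of a word of distinct integers is $(-1)^{\#\text{inversions}}$. $I_\lambda=\sum_{T\in\mathrm{SYT}(\lambda)}\mathrm{sgn}(T)$. $v(\lambda)$ is the maximal number of disjoint vertical dominoes ($2\times1$ rectangles) that fit in $\lambda$. -}

module Defs where

open import Data.Nat using (ℕ; zero; suc; _+_; _<_; _≤_; _≥_; _<?_)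
open import Data.Integer using (ℤ) renaming (_^_ to _^ℤ_; -1ℤ to -1ℤ)
open import Data.List using (List; []; _∷_; length; map; concat; concatMap; filter; upTo; foldr)
open import Data.Nat.ListAction using (sum)
import Data.Integer as ℤ
open import Relation.Binary.PropositionalEquality using (_≡_)
open import Data.List.Relation.Unary.All using (All)
open import Data.List.Relation.Unary.Linked using (Linked)
open import Data.List.Relation.Unary.Unique.Propositional using (Unique)
open import Data.List.Membership.Propositional using (_∈_)
open import Data.List.Relation.Binary.Permutation.Propositional using (_↭_)
open import Data.Product using (_×_; _,_; ∃-syntax)
open import Data.Unit using (⊤)
open import Data.Empty using (⊥)
open import Function.Bundles using (_⇔_)

-- Shapes (partitions), listed as their row lengths, top row first.

IsPartition : ℕ → List ℕ → Set
IsPartition n λs = All (1 ≤_) λs × Linked _≥_ λs × sum λs ≡ n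

-- Tableaux: a filling given as the list of its rows (top to bottom),
-- each row read left to right.

Tableau : Set
Tableau = List (List ℕ)

Above : List ℕ → List ℕ → Set
Above _        []       = ⊤
Above []       (_ ∷ _)  = ⊥
Above (x ∷ xs) (y ∷ ys) = x < y × Above xs ys

readingWord : Tableau → List ℕ
readingWord = concat

IsSYT : List ℕ → Tableau → Set
IsSYT λs T =
  map length T ≡ λs ×
  readingWord T ↭ map suc (upTo (sum λs)) ×
  All (Linked _<_) T ×
  Linked Above T

inversions : List ℕ → ℕ
inversions []       = 0
inversions (x ∷ xs) = length (filter (_<? x) xs) + inversions xs

sgnWord : List ℕ → ℤ
sgnWord w = -1ℤ ^ℤ inversions w

sgnT : Tableau → ℤ
sgnT T = sgnWord (readingWord T)

-- Vertical dominoes.  A cell is (row i , column j), 0-indexed.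
-- A vertical domino is given by its top cell (i , j); it occupies
-- (i , j) and (i+1 , j).

rowLength : List ℕ → ℕ → ℕ
rowLength []        _       = 0
rowLength (r ∷ _)   zero    = r
rowLength (_ ∷ rs)  (suc i) = rowLength rs i

InShape : List ℕ → ℕ × ℕ → Set
InShape λs (i , j) = j < rowLength λs i

cellsOf : List (ℕ × ℕ) → List (ℕ × ℕ)
cellsOf = concatMap (λ { (i , j) → (i , j) ∷ (suc i , j) ∷ [] })

IsDominoPacking : List ℕ → List (ℕ × ℕ) → Set
IsDominoPacking λs ds = All (InShape λs) (cellsOf ds) × Unique (cellsOf ds)

IsMaxVerticalDominoes : List ℕ → ℕ → Set
IsMaxVerticalDominoes λs k =
  (∃[ ds ] (IsDominoPacking λs ds × length ds ≡ k)) ×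
  (∀ ds → IsDominoPacking λs ds → length ds ≤ k)

Enumerates : {A : Set} → (A → Set) → List A → Set
Enumerates P xs = Unique xs × (∀ x → (x ∈ xs) ⇔ P x)

sumℤ : List ℤ → ℤ
sumℤ = foldr ℤ._+_ (ℤ.0ℤ)

{-# OPTIONS --safe #-}

-- Deleting the largest entry of a tableau changes its sign by (-1)^(number of cells in
-- lower rows), so the sign-imbalances of the shapes of size n form the vector Uⁿ ∅ for the
-- correspondingly signed up-operator U on Young's lattice.  Since v(λ) = λ₂ + λ₄ + ⋯, the
-- adjoint D of U for the form ⟨λ , μ⟩ = (-1)^v(λ) δ_λμ is again a signed down-operator.
-- Moves in different rows anticommute, and the diagonal contributions telescope along the
-- rows, whence D U + U D = 1.  So D Uⁿ ∅ is Uⁿ⁻¹ ∅ for odd n and 0 for even n, and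
-- ⟨Uⁿ ∅ , Uⁿ ∅⟩ = ⟨Uⁿ⁻¹ ∅ , D Uⁿ ∅⟩ vanishes after at most two such steps once n ≥ 2.

module Submission where

open import Defs
open import Data.Nat using (ℕ; zero; suc; pred; _≤_; _<_; _≥_; z≤n; s≤s; _<?_)
open import Data.Integer using (ℤ; _+_; _*_; -_; 0ℤ; 1ℤ; -1ℤ) renaming (_^_ to _^ℤ_)
open import Data.List using (List; []; _∷_; _++_; _∷ʳ_; map; length; concat; concatMap; drop; filter; upTo)
open import Data.List.Membership.Propositional using (_∈_; find; lose)
open import Data.List.Membership.Propositional.Properties using (∈-map⁺; ∈-map⁻; ∈-++⁺ˡ; ∈-++⁺ʳ; ∈-++⁻; ∈-concatMap⁺; ∈-concatMap⁻; ∈-upTo⁻; ∈-upTo⁺; ∈-filter⁺; ∈-filter⁻; ∈-∃++)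
open import Data.List.Membership.Propositional.Properties.WithK using (unique∧set⇒bag)
open import Data.List.Relation.Binary.BagAndSetEquality using (∼bag⇒↭)
open import Data.List.Relation.Binary.Permutation.Propositional using (_↭_; prep; ↭-sym; ↭-trans; ↭-reflexive; ↭⇒↭ₛ)
open import Data.List.Relation.Unary.All as All using (All; []; _∷_)
open import Data.List.Relation.Unary.AllPairs as AllPairs using (AllPairs; []; _∷_)
open import Data.List.Relation.Unary.Any using (here; there)
open import Data.List.Relation.Unary.Linked using (Linked; []; [-]; _∷_)
open import Data.List.Relation.Unary.Unique.Propositional using (Unique)
open import Data.Nat.ListAction using (sum)
open import Data.Nat.ListAction.Properties using (sum-++)
open import Data.Product using (_×_; _,_; proj₁; proj₂; ∃-syntax)
open import Data.Sum as Sum using (_⊎_; inj₁; inj₂)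
open import Data.Unit using (⊤; tt)
open import Data.Empty using (⊥)
open import Data.Integer.Tactic.RingSolver using (solve-∀)
open import Function using (_∘_; mk⇔; Equivalence)
open import Relation.Nullary using (¬_; yes; no; contradiction)
open import Relation.Unary using (Decidable)
open import Relation.Binary.PropositionalEquality using (_≡_; _≢_; refl; sym; trans; cong; cong₂; subst; setoid; module ≡-Reasoning)
open import Data.List.Relation.Binary.Permutation.Setoid.Properties (setoid ℤ) using (foldr-commMonoid)
import Data.Nat as ℕ
import Data.Nat.Properties as ℕ
import Data.Integer.Properties as ℤ
import Data.List.Properties as List
import Data.List.Relation.Binary.Permutation.Propositional.Properties as ↭
import Data.List.Relation.Unary.All.Properties as All
import Data.List.Relation.Unary.AllPairs.Properties as AllPairs
import Data.List.Relation.Unary.Unique.Propositional.Properties as Unique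

-- The sign of a move depends only on the cells below its row. A move in a lower row flips the sign
-- of a move above it, while a move above leaves the sign below alone; this one-sided dependence
-- makes moves in different rows anticommute. The form gives `D` the factor (-1)^r in row r, counted
-- from 0, because adding a cell there changes v exactly when r is odd. On the diagonal, row r
-- therefore gives (-1)^r for an addable cell and (-1)^r for a removable one. Row r has a removable
-- cell exactly when row r + 1 can grow, so consecutive rows cancel and only the addable cell of the
-- top row survives. The obstacle is that the pairing needs finite sums and a recursion on rows.
-- Hence shapes are confined to a box of N rows of length at most b, empty rows are kept so that
-- removing a cell never changes the number of rows, and `D` carries the length of the row above as
-- a bound. The boundary effects vanish on `I n` once the box is large compared with n.

Weight : Set
Weight = List ℕ → ℤ

-- Truncation factors, decreasing lists and signs

χ : ℕ → ℕ → ℤ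
χ _       zero    = 0ℤ
χ zero    (suc _) = 1ℤ
χ (suc m) (suc n) = χ m n

χ-< : ∀ {m n} → m < n → χ m n ≡ 1ℤ
χ-< {zero}  {suc _} _         = refl
χ-< {suc _} {suc _} (s≤s m<n) = χ-< m<n

χ-≥ : ∀ {m n} → n ≤ m → χ m n ≡ 0ℤ
χ-≥ {_}     {zero}  _         = refl
χ-≥ {suc _} {suc _} (s≤s n≤m) = χ-≥ n≤m

hd : List ℕ → ℕ
hd []      = 0
hd (a ∷ _) = a

hd≤sum : ∀ x → hd x ≤ sum x
hd≤sum []      = z≤n
hd≤sum (a ∷ x) = ℕ.m≤m+n a (sum x)

Decreasing≤ : ℕ → List ℕ → Set
Decreasing≤ _ []      = ⊤
Decreasing≤ b (a ∷ x) = a ≤ b × Decreasing≤ a x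

hd≤ : ∀ {b} x → Decreasing≤ b x → hd x ≤ b
hd≤ []      _         = z≤n
hd≤ (_ ∷ _) (a≤b , _) = a≤b

Decreasing≤-tighten : ∀ {a b} x → hd x ≤ a → Decreasing≤ b x → Decreasing≤ a x
Decreasing≤-tighten []      _   _       = _
Decreasing≤-tighten (_ ∷ _) c≤a (_ , d) = c≤a , d

-1^n*-1^n≡1 : ∀ n → (-1ℤ ^ℤ n) * (-1ℤ ^ℤ n) ≡ 1ℤ
-1^n*-1^n≡1 zero    = refl
-1^n*-1^n≡1 (suc n) = trans (square (-1ℤ ^ℤ n)) (-1^n*-1^n≡1 n)
  where
  square : ∀ s → (-1ℤ * s) * (-1ℤ * s) ≡ s * s
  square = solve-∀

σ : Weight
σ x = -1ℤ ^ℤ sum x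

σ*σ : ∀ x → σ x * σ x ≡ 1ℤ
σ*σ x = -1^n*-1^n≡1 (sum x)

σ*σ-cancel : ∀ x p → (σ x * σ x) * p ≡ p
σ*σ-cancel x p = trans (cong (_* p) (σ*σ x)) (ℤ.*-identityˡ p)

σ-∷ : ∀ a x → σ (a ∷ x) ≡ (-1ℤ ^ℤ a) * σ x
σ-∷ a x = ℤ.^-distribˡ-+-* -1ℤ a (sum x)

-- A weight stands for the vector with these coefficients, so the value of U f at x involves
-- f at the shapes below x.  Shapes may end in empty rows.
U : Weight → Weight
U f []      = 0ℤ
U f (a ∷ x) = χ (hd x) a * (σ x * f (pred a ∷ x)) + U (f ∘ (a ∷_)) x

-- The bound b is the length of the row above x (when x is the tail of a longer shape).
D : ℕ → Weight → Weight
D b f []      = χ 0 b * f (1 ∷ [])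
D b f (a ∷ x) = χ a b * (σ x * f (suc a ∷ x)) + - D a (f ∘ (a ∷_)) x

-- Linearity, congruence and sign rules for the two operators

U-lin : ∀ c f g x → U (λ y → c * f y + - g y) x ≡ c * U f x + - U g x
U-lin c f g []      = base c
  where
  base : ∀ c → 0ℤ ≡ c * 0ℤ + - 0ℤ
  base = solve-∀
U-lin c f g (a ∷ x) = trans
  (cong (χ (hd x) a * (σ x * (c * f (pred a ∷ x) + - g (pred a ∷ x))) +_)
        (U-lin c (f ∘ (a ∷_)) (g ∘ (a ∷_)) x))
  (step c (χ (hd x) a) (σ x) (f (pred a ∷ x)) (g (pred a ∷ x)) _ _)
  where
  step : ∀ c k s p q u v →
    k * (s * (c * p + - q)) + (c * u + - v) ≡ c * (k * (s * p) + u) + - (k * (s * q) + v)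
  step = solve-∀

-- The factor `χ` is zero whenever a removal would break monotonicity, so agreement on decreasing
-- lists is enough. `D-I` needs this version, since its formula is proved for such lists only.
U-cong : ∀ {b} f g → (∀ y → Decreasing≤ b y → f y ≡ g y) →
         ∀ x → Decreasing≤ b x → U f x ≡ U g x
U-cong f g f≗g [] _ = refl
U-cong f g f≗g (a ∷ x) (a≤b , dx) = cong₂ _+_ (first a a≤b dx)
  (U-cong (f ∘ (a ∷_)) (g ∘ (a ∷_)) (λ y dy → f≗g (a ∷ y) (a≤b , dy)) x dx)
  where
  first : ∀ a → a ≤ _ → Decreasing≤ a x →
    χ (hd x) a * (σ x * f (pred a ∷ x)) ≡ χ (hd x) a * (σ x * g (pred a ∷ x))
  first zero    _   _  = refl
  first (suc k) k<b dx with hd x ℕ.≤? k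
  ... | yes h = cong (λ z → χ (hd x) (suc k) * (σ x * z))
                  (f≗g (k ∷ x) (ℕ.<⇒≤ k<b , Decreasing≤-tighten x h dx))
  ... | no ¬h rewrite χ-≥ (ℕ.≰⇒> ¬h) = refl

U-scale : ∀ c f x → U (λ y → c * f y) x ≡ c * U f x
U-scale c f []      = sym (ℤ.*-zeroʳ c)
U-scale c f (a ∷ x) = trans
  (cong (χ (hd x) a * (σ x * (c * f (pred a ∷ x))) +_) (U-scale c (f ∘ (a ∷_)) x))
  (step c (χ (hd x) a) (σ x) (f (pred a ∷ x)) _)
  where
  step : ∀ c k s p u → k * (s * (c * p)) + c * u ≡ c * (k * (s * p) + u)
  step = solve-∀

U-congᵖ : ∀ {f g} → (∀ y → f y ≡ g y) → ∀ x → U f x ≡ U g x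
U-congᵖ f≗g []      = refl
U-congᵖ f≗g (a ∷ x) = cong₂ _+_
  (cong (λ z → χ (hd x) a * (σ x * z)) (f≗g (pred a ∷ x))) (U-congᵖ (f≗g ∘ (a ∷_)) x)

D-congᵖ : ∀ b {f g} → (∀ y → f y ≡ g y) → ∀ x → D b f x ≡ D b g x
D-congᵖ b f≗g []      = cong (χ 0 b *_) (f≗g _)
D-congᵖ b f≗g (a ∷ x) = cong₂ (λ p q → χ a b * (σ x * p) + - q)
  (f≗g (suc a ∷ x)) (D-congᵖ a (f≗g ∘ (a ∷_)) x)

D-+ : ∀ b f g x → D b (λ y → f y + g y) x ≡ D b f x + D b g x
D-+ b f g []      = ℤ.*-distribˡ-+ (χ 0 b) (f (1 ∷ [])) (g (1 ∷ []))
D-+ b f g (a ∷ x) = trans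
  (cong (λ z → χ a b * (σ x * (f (suc a ∷ x) + g (suc a ∷ x))) + - z)
        (D-+ a (f ∘ (a ∷_)) (g ∘ (a ∷_)) x))
  (step (χ a b) (σ x) (f (suc a ∷ x)) (g (suc a ∷ x)) _ _)
  where
  step : ∀ k s p q u v →
    k * (s * (p + q)) + - (u + v) ≡ (k * (s * p) + - u) + (k * (s * q) + - v)
  step = solve-∀

D-scale : ∀ b c f x → D b (λ y → c * f y) x ≡ c * D b f x
D-scale b c f []      = step (χ 0 b) c (f (1 ∷ []))
  where
  step : ∀ k c p → k * (c * p) ≡ c * (k * p)
  step = solve-∀
D-scale b c f (a ∷ x) = trans
  (cong (λ z → χ a b * (σ x * (c * f (suc a ∷ x))) + - z) (D-scale a c (f ∘ (a ∷_)) x))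
  (step (χ a b) (σ x) c (f (suc a ∷ x)) _)
  where
  step : ∀ k s c p u → k * (s * (c * p)) + - (c * u) ≡ c * (k * (s * p) + - u)
  step = solve-∀

-- `U` reads its argument one size lower, and `σ` is the parity of the size. As `σ` is also the sign
-- that a row receives from the rows below it, this is the source of anticommutation.
U-σ : ∀ f x → U (λ y → σ y * f y) x ≡ - (σ x * U f x)
U-σ f []      = refl
U-σ f (a ∷ x) = begin
  χ (hd x) a * (σ x * (σ (pred a ∷ x) * p)) + U (λ y → σ (a ∷ y) * f (a ∷ y)) x
    ≡⟨ cong₂ _+_ (first a) rest ⟩
  - (σ (a ∷ x) * (χ (hd x) a * (σ x * p))) + - (σ (a ∷ x) * U (f ∘ (a ∷_)) x)
    ≡⟨ step (σ (a ∷ x)) _ _ ⟩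
  - (σ (a ∷ x) * (χ (hd x) a * (σ x * p) + U (f ∘ (a ∷_)) x)) ∎
  where
  open ≡-Reasoning
  p : ℤ
  p = f (pred a ∷ x)
  step : ∀ s u v → - (s * u) + - (s * v) ≡ - (s * (u + v))
  step = solve-∀
  zeroterm : ∀ s → 0ℤ ≡ - (s * 0ℤ)
  zeroterm = solve-∀
  sucterm : ∀ k s t p → k * (s * (t * p)) ≡ - ((-1ℤ * t) * (k * (s * p)))
  sucterm = solve-∀
  first : ∀ a → χ (hd x) a * (σ x * (σ (pred a ∷ x) * p)) ≡ - (σ (a ∷ x) * (χ (hd x) a * (σ x * p)))
  first zero    = zeroterm (σ (0 ∷ x))
  first (suc k) = sucterm (χ (hd x) (suc k)) (σ x) (σ (k ∷ x)) p
  assoc : ∀ m s u → m * - (s * u) ≡ - ((m * s) * u)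
  assoc = solve-∀
  rest : U (λ y → σ (a ∷ y) * f (a ∷ y)) x ≡ - (σ (a ∷ x) * U (f ∘ (a ∷_)) x)
  rest = begin
    U (λ y → σ (a ∷ y) * f (a ∷ y)) x
      ≡⟨ U-congᵖ (λ y → trans (cong (_* f (a ∷ y)) (σ-∷ a y)) (ℤ.*-assoc (-1ℤ ^ℤ a) (σ y) _)) x ⟩
    U (λ y → (-1ℤ ^ℤ a) * (σ y * f (a ∷ y))) x
      ≡⟨ U-scale (-1ℤ ^ℤ a) (λ y → σ y * f (a ∷ y)) x ⟩
    (-1ℤ ^ℤ a) * U (λ y → σ y * f (a ∷ y)) x
      ≡⟨ cong ((-1ℤ ^ℤ a) *_) (U-σ (f ∘ (a ∷_)) x) ⟩
    (-1ℤ ^ℤ a) * - (σ x * U (f ∘ (a ∷_)) x)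
      ≡⟨ assoc (-1ℤ ^ℤ a) (σ x) _ ⟩
    - (((-1ℤ ^ℤ a) * σ x) * U (f ∘ (a ∷_)) x)
      ≡⟨ cong (λ z → - (z * U (f ∘ (a ∷_)) x)) (σ-∷ a x) ⟨
    - (σ (a ∷ x) * U (f ∘ (a ∷_)) x) ∎

mutual
  D-σ : ∀ b f x → D b (λ y → σ y * f y) x ≡ - (σ x * D b f x)
  D-σ b f []      = base (χ 0 b) (f (1 ∷ []))
    where
    base : ∀ k p → k * (-1ℤ * p) ≡ - (1ℤ * (k * p))
    base = solve-∀
  D-σ b f (a ∷ x) = trans
    (cong (λ z → χ a b * (σ x * (σ (suc a ∷ x) * f (suc a ∷ x))) + - z) (D-σ-∷ a a f x))
    (step (χ a b) (σ x) (σ (a ∷ x)) (f (suc a ∷ x)) _)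
    where
    step : ∀ k s t p u →
      k * (s * ((-1ℤ * t) * p)) + - - (t * u) ≡ - (t * (k * (s * p) + - u))
    step = solve-∀

  -- The prefixed row contributes only the constant `-1ℤ ^ℤ a`, which linearity pulls out. The
  -- recursion is mutual because `D` itself recurses under a prefixed row.
  D-σ-∷ : ∀ b a f x → D b (λ y → σ (a ∷ y) * f (a ∷ y)) x ≡ - (σ (a ∷ x) * D b (f ∘ (a ∷_)) x)
  D-σ-∷ b a f x = begin
    D b (λ y → σ (a ∷ y) * f (a ∷ y)) x
      ≡⟨ D-congᵖ b (λ y → trans (cong (_* f (a ∷ y)) (σ-∷ a y)) (ℤ.*-assoc (-1ℤ ^ℤ a) (σ y) _)) x ⟩
    D b (λ y → (-1ℤ ^ℤ a) * (σ y * f (a ∷ y))) x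
      ≡⟨ D-scale b (-1ℤ ^ℤ a) (λ y → σ y * f (a ∷ y)) x ⟩
    (-1ℤ ^ℤ a) * D b (λ y → σ y * f (a ∷ y)) x
      ≡⟨ cong ((-1ℤ ^ℤ a) *_) (D-σ b (f ∘ (a ∷_)) x) ⟩
    (-1ℤ ^ℤ a) * - (σ x * D b (f ∘ (a ∷_)) x)
      ≡⟨ assoc (-1ℤ ^ℤ a) (σ x) _ ⟩
    - (((-1ℤ ^ℤ a) * σ x) * D b (f ∘ (a ∷_)) x)
      ≡⟨ cong (λ z → - (z * D b (f ∘ (a ∷_)) x)) (σ-∷ a x) ⟨
    - (σ (a ∷ x) * D b (f ∘ (a ∷_)) x) ∎
    where
    open ≡-Reasoning
    assoc : ∀ m s u → m * - (s * u) ≡ - ((m * s) * u)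
    assoc = solve-∀

-- Cutting off at a first row shorter than suc k lowers the bound on D to k.
D-χ : ∀ k h x → D (suc k) (λ y → χ (hd y) (suc k) * (σ y * h y)) x
              ≡ - (χ (hd x) (suc k) * (σ x * D k h x))
D-χ k h [] = base (χ 0 k) (h (1 ∷ []))
  where
  base : ∀ c p → 1ℤ * (c * (-1ℤ * p)) ≡ - (1ℤ * (1ℤ * (c * p)))
  base = solve-∀
D-χ k h (c ∷ x) = begin
  χ c (suc k) * (σ x * (χ c k * (σ (suc c ∷ x) * p))) +
    - D c (λ y → χ c (suc k) * (σ (c ∷ y) * h (c ∷ y))) x
    ≡⟨ cong (λ z → χ c (suc k) * (σ x * (χ c k * (σ (suc c ∷ x) * p))) + - z)
         (trans (D-scale c (χ c (suc k)) (λ y → σ (c ∷ y) * h (c ∷ y)) x)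
                (cong (χ c (suc k) *_) (D-σ-∷ c c h x))) ⟩
  χ c (suc k) * (σ x * (χ c k * (σ (suc c ∷ x) * p))) +
    - (χ c (suc k) * - (σ (c ∷ x) * D c (h ∘ (c ∷_)) x))
    ≡⟨ step (χ c (suc k)) (σ x) (χ c k) (σ (c ∷ x)) p _ ⟩
  - (χ c (suc k) * (σ (c ∷ x) * (χ c k * (σ x * p) + - D c (h ∘ (c ∷_)) x))) ∎
  where
  open ≡-Reasoning
  p : ℤ
  p = h (suc c ∷ x)
  step : ∀ a s b t p u → a * (s * (b * ((-1ℤ * t) * p))) + - (a * - (t * u))
                       ≡ - (a * (t * (b * (s * p) + - u)))
  step = solve-∀

-- The relation between the up- and down-operators

-- Needed once `D` opens a new row: removing that cell again leads to `0 ∷ []` instead of `[]`.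
IgnoresFinalZero : Weight → Set
IgnoresFinalZero f = ∀ x → f (x ++ 0 ∷ []) ≡ f x

-- Induction on the rows. Mixed terms cancel, the top row yields `A + B` (addable plus removable),
-- and the tail, bounded by `a`, subtracts exactly `B`. Keeping the addability of the top row under
-- `b` on the right, in place of 1, is what lets the induction telescope.
DU+UD : ∀ b f → IgnoresFinalZero f → ∀ x → Decreasing≤ b x →
        D b (U f) x + U (D b f) x ≡ χ (hd x) b * f x
DU+UD b f fz [] _ = trans (base (χ 0 b) (f (0 ∷ []))) (cong (χ 0 b *_) (fz []))
  where
  base : ∀ k p → k * (1ℤ * (1ℤ * p) + 0ℤ) + 0ℤ ≡ k * p
  base = solve-∀
DU+UD b f fz (a ∷ x) (a≤b , dx) = begin
  D b (U f) (a ∷ x) + U (D b f) (a ∷ x)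
    ≡⟨ cong₂ _+_ du ud ⟩
  A * (s * (1ℤ * (s * F) + u)) + - (- (B * (s * d a)) + du′) +
    (B * (s * (1ℤ * (s * F) + - d a)) + (A * - (s * u) + - ud′))
    ≡⟨ collect A s F u B (d a) du′ ud′ ⟩
  (A + B) * (s * s) * F + - (du′ + ud′)
    ≡⟨ cong₂ (λ y z → (A + B) * y * F + - z) (σ*σ x) (DU+UD a g (fz ∘ (a ∷_)) x dx) ⟩
  (A + B) * 1ℤ * F + - (B * F)
    ≡⟨ cancel A B F ⟩
  A * F ∎
  where
  open ≡-Reasoning
  g : Weight
  g = f ∘ (a ∷_)
  A s F u B du′ ud′ : ℤ
  A = χ a b
  s = σ x
  F = f (a ∷ x)
  u = U (f ∘ (suc a ∷_)) x
  B = χ (hd x) a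
  du′ = D a (U g) x
  ud′ = U (D a g) x
  d : ℕ → ℤ
  d a = D (pred a) (f ∘ (pred a ∷_)) x

  collect : ∀ A s F u B d e h →
    A * (s * (1ℤ * (s * F) + u)) + - (- (B * (s * d)) + e) +
      (B * (s * (1ℤ * (s * F) + - d)) + (A * - (s * u) + - h))
    ≡ (A + B) * (s * s) * F + - (e + h)
  collect = solve-∀
  cancel : ∀ A B F → (A + B) * 1ℤ * F + - (B * F) ≡ A * F
  cancel = solve-∀

  -- Removing from the top row and adding below it, in either order, must leave a second row that
  -- fits under `pred a`; hence the lowered bound in `d`.
  cut : ∀ a → D a (λ y → χ (hd y) a * (σ y * f (pred a ∷ y))) x ≡ - (χ (hd x) a * (s * d a))
  cut zero    = D-scale 0 0ℤ (λ y → σ y * f (0 ∷ y)) x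
  cut (suc k) = D-χ k (f ∘ (k ∷_)) x

  du : D b (U f) (a ∷ x) ≡ A * (s * (1ℤ * (s * F) + u)) + - (- (B * (s * d a)) + du′)
  du = cong₂ (λ y z → A * (s * (y * (s * F) + u)) + - z)
    -- A cell just added to the top row can always be removed again.
    (χ-< (s≤s (hd≤ x dx)))
    (trans (D-+ a (λ y → χ (hd y) a * (σ y * f (pred a ∷ y))) (U g) x) (cong (_+ du′) (cut a)))

  -- After a removal the top row has room under `b`, so the inner factor is 1; for `a = 0` the outer
  -- factor is already zero.
  removed : ∀ a → a ≤ b →
    χ (hd x) a * (s * D b f (pred a ∷ x)) ≡ χ (hd x) a * (s * (1ℤ * (s * f (a ∷ x)) + - d a))
  removed zero    _   = refl
  removed (suc k) k<b =
    cong (λ z → χ (hd x) (suc k) * (s * (z * (s * f (suc k ∷ x)) + - d (suc k)))) (χ-< k<b)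

  ud : U (D b f) (a ∷ x) ≡ B * (s * (1ℤ * (s * F) + - d a)) + (A * - (s * u) + - ud′)
  ud = cong₂ _+_ (removed a a≤b)
    (trans (U-lin A (λ y → σ y * f (suc a ∷ y)) (D a g) x)
           (cong (λ z → A * z + - ud′) (U-σ (f ∘ (suc a ∷_)) x)))

-- Sign-imbalances as iterates of the up-operator

δ₀ : ℕ → ℤ
δ₀ zero    = 1ℤ
δ₀ (suc _) = 0ℤ

-- I n is the sign-imbalance on shapes of size n, extended by zero.
I : ℕ → Weight
I zero    x = δ₀ (sum x)
I (suc n) x = U (I n) x

U-vanishes : ∀ f x → (∀ y → suc (sum y) ≡ sum x → f y ≡ 0ℤ) → U f x ≡ 0ℤ
U-vanishes f []      _  = refl
U-vanishes f (a ∷ x) f0 = cong₂ _+_ (first a f0)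
  (U-vanishes (f ∘ (a ∷_)) x
    (λ y e → f0 (a ∷ y) (trans (sym (ℕ.+-suc a (sum y))) (cong (a ℕ.+_) e))))
  where
  zeros : ∀ k s → k * (s * 0ℤ) ≡ 0ℤ
  zeros = solve-∀
  first : ∀ a → (∀ y → suc (sum y) ≡ a ℕ.+ sum x → f y ≡ 0ℤ) →
    χ (hd x) a * (σ x * f (pred a ∷ x)) ≡ 0ℤ
  first zero    _  = refl
  first (suc k) f0 rewrite f0 (k ∷ x) refl = zeros (χ (hd x) (suc k)) (σ x)

I-vanishes : ∀ n x → sum x ≢ n → I n x ≡ 0ℤ
I-vanishes zero x s≢n with sum x
... | zero  = contradiction refl s≢n
... | suc _ = refl
I-vanishes (suc n) x s≢n = U-vanishes (I n) x
  (λ y e → I-vanishes n y (λ e′ → s≢n (trans (sym e) (cong suc e′))))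

hd-++0 : ∀ x → hd (x ++ 0 ∷ []) ≡ hd x
hd-++0 []      = refl
hd-++0 (_ ∷ _) = refl

sum-++0 : ∀ x → sum (x ++ 0 ∷ []) ≡ sum x
sum-++0 x = trans (sum-++ x (0 ∷ [])) (ℕ.+-identityʳ (sum x))

U-ignoresFinalZero : ∀ f → IgnoresFinalZero f → IgnoresFinalZero (U f)
U-ignoresFinalZero f fz []      = refl
U-ignoresFinalZero f fz (a ∷ x) rewrite hd-++0 x | sum-++0 x = cong₂ _+_
  (cong (λ z → χ (hd x) a * (σ x * z)) (fz (pred a ∷ x)))
  (U-ignoresFinalZero (f ∘ (a ∷_)) (fz ∘ (a ∷_)) x)

I-ignoresFinalZero : ∀ n → IgnoresFinalZero (I n)
I-ignoresFinalZero zero    x = cong δ₀ (sum-++0 x)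
I-ignoresFinalZero (suc n)   = U-ignoresFinalZero (I n) (I-ignoresFinalZero n)

-- The coefficient of `I n` in `D (I (suc n))` is `parity (suc n)`; the recursion mirrors D U = 1 -
-- U D, and the values alternate 0, 1, 0, 1.
parity : ℕ → ℤ
parity zero    = 0ℤ
parity (suc n) = 1ℤ + - parity n

parity-consecutive : ∀ n → parity (suc n) * parity n ≡ 0ℤ
parity-consecutive zero    = refl
parity-consecutive (suc n) = trans (step (parity n)) (parity-consecutive n)
  where
  step : ∀ p → (1ℤ + - (1ℤ + - p)) * (1ℤ + - p) ≡ (1ℤ + - p) * p
  step = solve-∀

D-vanishes : ∀ b f x → (∀ y → sum y ≡ suc (sum x) → f y ≡ 0ℤ) → D b f x ≡ 0ℤ
D-vanishes b f []      f0 rewrite f0 (1 ∷ []) refl = ℤ.*-zeroʳ (χ 0 b)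
D-vanishes b f (a ∷ x) f0
  rewrite f0 (suc a ∷ x) refl
        | D-vanishes a (f ∘ (a ∷_)) x
            (λ y e → f0 (a ∷ y) (trans (cong (a ℕ.+_) e) (ℕ.+-suc a (sum x))))
  = zeros (χ a b) (σ x)
  where
  zeros : ∀ k s → k * (s * 0ℤ) + - 0ℤ ≡ 0ℤ
  zeros = solve-∀

-- On the support of `I n` the top row has at most n cells, and elsewhere both sides vanish. This
-- turns the truncated `DU+UD` into D U + U D = 1.
χ-I : ∀ {n b} → n < b → ∀ x → χ (hd x) b * I n x ≡ I n x
χ-I {n} {b} n<b x with sum x ℕ.≟ n
... | yes refl rewrite χ-< (ℕ.≤-<-trans (hd≤sum x) n<b) = ℤ.*-identityˡ (I n x)
... | no s≢n   rewrite I-vanishes n x s≢n = ℤ.*-zeroʳ (χ (hd x) b)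

-- The relation gives `I n` minus U D applied to `I n`. By induction `D` sends `I n` to a multiple
-- of its predecessor, which `U` carries back to `I n`.
D-I : ∀ n {b} → n < b → ∀ x → Decreasing≤ b x → D b (I (suc n)) x ≡ parity (suc n) * I n x
D-I n {b} n<b x dx = begin
  D b (I (suc n)) x
    ≡⟨ move (D b (I (suc n)) x) (U (D b (I n)) x) ⟩
  (D b (U (I n)) x + U (D b (I n)) x) + - U (D b (I n)) x
    ≡⟨ cong₂ (λ y z → y + - z)
         (trans (DU+UD b (I n) (I-ignoresFinalZero n) x dx) (χ-I n<b x)) (ud n n<b) ⟩
  I n x + - (parity n * I n x)
    ≡⟨ factor (parity n) (I n x) ⟩
  parity (suc n) * I n x ∎
  where
  open ≡-Reasoning
  move : ∀ p q → p ≡ (p + q) + - q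
  move = solve-∀
  factor : ∀ p i → i + - (p * i) ≡ (1ℤ + - p) * i
  factor = solve-∀
  ud : ∀ n → n < b → U (D b (I n)) x ≡ parity n * I n x
  -- `D` reads its argument one size higher, so never at size 0, where `I 0` is supported.
  ud zero    _   = U-vanishes (D b (I 0)) x
    (λ y _ → D-vanishes b (I 0) y (λ z e → cong δ₀ e))
  ud (suc m) m<b = trans
    (U-cong (D b (I (suc m))) (λ y → parity (suc m) * I m y) (D-I m (ℕ.<⇒≤ m<b)) x dx)
    (U-scale (parity (suc m)) (I m) x)

-- V x = (-1)^(x₂ + x₄ + ⋯), because x₁ + x₃ + ⋯ = sum x - (x₂ + x₄ + ⋯).
V : Weight
V []      = 1ℤ
V (_ ∷ x) = σ x * V x

-- Sums over a box and adjointness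

sumTo : ℕ → (ℕ → ℤ) → ℤ
sumTo zero    F = F 0
sumTo (suc b) F = sumTo b F + F (suc b)

sumTo-cong : ∀ b {F G} → (∀ a → a ≤ b → F a ≡ G a) → sumTo b F ≡ sumTo b G
sumTo-cong zero    e = e 0 z≤n
sumTo-cong (suc b) e = cong₂ _+_ (sumTo-cong b (λ a a≤b → e a (ℕ.m≤n⇒m≤1+n a≤b))) (e (suc b) ℕ.≤-refl)

sumTo-lin : ∀ b c F G → sumTo b (λ a → c * F a + G a) ≡ c * sumTo b F + sumTo b G
sumTo-lin zero    c F G = refl
sumTo-lin (suc b) c F G = trans (cong (_+ (c * F (suc b) + G (suc b))) (sumTo-lin b c F G))
  (step c (sumTo b F) (sumTo b G) (F (suc b)) (G (suc b)))
  where
  step : ∀ c p q u v → (c * p + q) + (c * u + v) ≡ c * (p + u) + (q + v)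
  step = solve-∀

sumTo-shift : ∀ b F → sumTo (suc b) F ≡ F 0 + sumTo b (F ∘ suc)
sumTo-shift zero    F = refl
sumTo-shift (suc b) F = trans (cong (_+ F (suc (suc b))) (sumTo-shift b F)) (ℤ.+-assoc (F 0) _ _)

-- Matches a row of length a + 1 losing a cell with a row of length a gaining one. A row of length
-- `b` cannot grow inside the box, hence the factor `χ a b`.
sumTo-reindex : ∀ b (F G : ℕ → ℤ) → F 0 ≡ 0ℤ → (∀ a → F (suc a) ≡ G a) →
                sumTo b F ≡ sumTo b (λ a → χ a b * G a)
sumTo-reindex zero    F G F0 _  = F0
sumTo-reindex (suc b) F G F0 FG = begin
  sumTo (suc b) F                                           ≡⟨ sumTo-shift b F ⟩
  F 0 + sumTo b (F ∘ suc)                                   ≡⟨ cong₂ _+_ F0 (sumTo-cong b inside) ⟩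
  0ℤ + sumTo b (λ a → χ a (suc b) * G a)                    ≡⟨ ℤ.+-comm 0ℤ (sumTo b (λ a → χ a (suc b) * G a)) ⟩
  sumTo b (λ a → χ a (suc b) * G a) + 0ℤ
    ≡⟨ cong (λ z → sumTo b (λ a → χ a (suc b) * G a) + z * G (suc b)) (χ-≥ (ℕ.≤-refl {suc b})) ⟨
  sumTo b (λ a → χ a (suc b) * G a) + χ (suc b) (suc b) * G (suc b) ∎
  where
  open ≡-Reasoning
  inside : ∀ a → a ≤ b → F (suc a) ≡ χ a (suc b) * G a
  inside a a≤b = trans (FG a)
    (trans (sym (ℤ.*-identityˡ (G a))) (cong (_* G a) (sym (χ-< (s≤s a≤b)))))

-- Shapes with exactly N rows, some of which may be empty; box below lists the same shapes
-- without empty rows.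
boxSum : ℕ → ℕ → Weight → ℤ
boxSum zero    b f = f []
boxSum (suc N) b f = sumTo b (λ a → boxSum N a (f ∘ (a ∷_)))

boxSum-cong : ∀ N b {f g} → (∀ x → Decreasing≤ b x → f x ≡ g x) → boxSum N b f ≡ boxSum N b g
boxSum-cong zero    b e = e [] _
boxSum-cong (suc N) b e = sumTo-cong b
  (λ a a≤b → boxSum-cong N a (λ x dx → e (a ∷ x) (a≤b , dx)))

boxSum-lin : ∀ N b c f g → boxSum N b (λ x → c * f x + g x) ≡ c * boxSum N b f + boxSum N b g
boxSum-lin zero    b c f g = refl
boxSum-lin (suc N) b c f g = trans
  (sumTo-cong b (λ a _ → boxSum-lin N a c (f ∘ (a ∷_)) (g ∘ (a ∷_))))
  (sumTo-lin b c (λ a → boxSum N a (f ∘ (a ∷_))) (λ a → boxSum N a (g ∘ (a ∷_))))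

-- No induction: `-1ℤ * 0ℤ + 0ℤ` computes to `0ℤ`, so linearity says that the sum Z equals -Z + Z.
boxSum-zero : ∀ N b → boxSum N b (λ _ → 0ℤ) ≡ 0ℤ
boxSum-zero N b = trans (boxSum-lin N b -1ℤ (λ _ → 0ℤ) (λ _ → 0ℤ)) (cancel (boxSum N b (λ _ → 0ℤ)))
  where
  cancel : ∀ z → -1ℤ * z + z ≡ 0ℤ
  cancel = solve-∀

boxSum-scale : ∀ N b c f → boxSum N b (λ x → c * f x) ≡ c * boxSum N b f
boxSum-scale N b c f = begin
  boxSum N b (λ x → c * f x)                ≡⟨ boxSum-cong N b (λ x _ → sym (ℤ.+-identityʳ (c * f x))) ⟩
  boxSum N b (λ x → c * f x + 0ℤ)           ≡⟨ boxSum-lin N b c f (λ _ → 0ℤ) ⟩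
  c * boxSum N b f + boxSum N b (λ _ → 0ℤ)  ≡⟨ cong (c * boxSum N b f +_) (boxSum-zero N b) ⟩
  c * boxSum N b f + 0ℤ                     ≡⟨ ℤ.+-identityʳ _ ⟩
  c * boxSum N b f ∎
  where open ≡-Reasoning

-- The tails that permit a removal from a row of length `suc k` are exactly those that fit under the
-- shortened row.
boxSum-χ : ∀ N k h → boxSum N (suc k) (λ x → χ (hd x) (suc k) * h x) ≡ boxSum N k h
boxSum-χ zero    k h = ℤ.*-identityˡ (h [])
boxSum-χ (suc N) k h = begin
  sumTo k (λ a → boxSum N a (λ x → χ a (suc k) * h (a ∷ x))) +
    boxSum N (suc k) (λ x → χ (suc k) (suc k) * h (suc k ∷ x))
    ≡⟨ cong₂ _+_ (sumTo-cong k inside) outside ⟩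
  sumTo k (λ a → boxSum N a (h ∘ (a ∷_))) + 0ℤ
    ≡⟨ ℤ.+-identityʳ _ ⟩
  sumTo k (λ a → boxSum N a (h ∘ (a ∷_))) ∎
  where
  open ≡-Reasoning
  inside : ∀ a → a ≤ k → boxSum N a (λ x → χ a (suc k) * h (a ∷ x)) ≡ boxSum N a (h ∘ (a ∷_))
  inside a a≤k = boxSum-cong N a
    (λ x _ → trans (cong (_* h (a ∷ x)) (χ-< (s≤s a≤k))) (ℤ.*-identityˡ _))
  outside : boxSum N (suc k) (λ x → χ (suc k) (suc k) * h (suc k ∷ x)) ≡ 0ℤ
  outside = trans
    (boxSum-cong N (suc k) (λ x _ → cong (_* h (suc k ∷ x)) (χ-≥ (ℕ.≤-refl {suc k}))))
    (boxSum-zero N (suc k))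

-- The hypothesis on f makes D harmless where it would leave the box through the bottom.
adjoint : ∀ N b f g → b ≡ 0 ⊎ (∀ x → N < sum x → f x ≡ 0ℤ) →
          boxSum N b (λ x → V x * (f x * U g x)) ≡ boxSum N b (λ x → V x * (g x * D b f x))
adjoint zero b f g h = trans (leftZero (f [])) (sym (right h))
  where
  leftZero : ∀ p → 1ℤ * (p * 0ℤ) ≡ 0ℤ
  leftZero = solve-∀
  rightZero : ∀ k p → 1ℤ * (p * (k * 0ℤ)) ≡ 0ℤ
  rightZero = solve-∀
  right : b ≡ 0 ⊎ (∀ x → 0 < sum x → f x ≡ 0ℤ) → 1ℤ * (g [] * (χ 0 b * f (1 ∷ []))) ≡ 0ℤ
  right (inj₁ refl) = leftZero (g [])
  right (inj₂ f0) rewrite f0 (1 ∷ []) (s≤s z≤n) = rightZero (χ 0 b) (g [])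
adjoint (suc N) b f g h = begin
  sumTo b (λ a → boxSum N a (λ x → V (a ∷ x) * (f (a ∷ x) * U g (a ∷ x))))
    ≡⟨ sumTo-cong b left ⟩
  sumTo b (λ a → -1ℤ * below a + removed a)
    ≡⟨ sumTo-lin b -1ℤ below removed ⟩
  -1ℤ * sumTo b below + sumTo b removed
    ≡⟨ cong (-1ℤ * sumTo b below +_) (sumTo-reindex b removed added removed-zero removed-suc) ⟩
  -1ℤ * sumTo b below + sumTo b (λ a → χ a b * added a)
    ≡⟨ sumTo-lin b -1ℤ below (λ a → χ a b * added a) ⟨
  sumTo b (λ a → -1ℤ * below a + χ a b * added a)
    ≡⟨ sumTo-cong b (λ a _ → right a) ⟨
  sumTo b (λ a → boxSum N a (λ x → V (a ∷ x) * (g (a ∷ x) * D b f (a ∷ x)))) ∎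
  where
  open ≡-Reasoning
  below removed added : ℕ → ℤ
  below a   = boxSum N a (λ x → V x * ((σ x * g (a ∷ x)) * D a (f ∘ (a ∷_)) x))
  removed a = boxSum N a (λ x → χ (hd x) a * (V x * (f (a ∷ x) * g (pred a ∷ x))))
  added a   = boxSum N a (λ x → V x * (f (suc a ∷ x) * g (a ∷ x)))

  removed-zero : removed 0 ≡ 0ℤ
  removed-zero = boxSum-zero N 0

  removed-suc : ∀ a → removed (suc a) ≡ added a
  removed-suc a = boxSum-χ N a (λ x → V x * (f (suc a ∷ x) * g (a ∷ x)))

  -- A nonempty top row uses up at least one cell, which pays for passing from `suc N` to `N`. An
  -- empty one pays nothing, but nothing can be added below it; this is why the hypothesis is a
  -- disjunction.
  support : ∀ a → a ≤ b → a ≡ 0 ⊎ (∀ x → N < sum x → f (a ∷ x) ≡ 0ℤ)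
  support zero    _   = inj₁ refl
  support (suc a) a<b = Sum.map (λ b≡0 → contradiction (subst (suc a ≤_) b≡0 a<b) λ ())
    (λ f0 x N<s → f0 (suc a ∷ x) (s≤s (ℕ.≤-trans N<s (ℕ.m≤n+m (sum x) a)))) h

  -- Since `V (a ∷ x)` is `σ x * V x`, the factor `σ x` squares away in the top-row term. In the
  -- other term `U-σ` moves it onto `g` at the cost of a minus sign, the one that `D` carries.
  expandˡ : ∀ s v p k q u →
    (s * v) * (p * (k * (s * q) + u)) ≡ -1ℤ * (v * (p * - (s * u))) + (s * s) * (k * (v * (p * q)))
  expandˡ = solve-∀

  left : ∀ a → a ≤ b → boxSum N a (λ x → V (a ∷ x) * (f (a ∷ x) * U g (a ∷ x)))
                     ≡ -1ℤ * below a + removed a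
  left a a≤b = begin
    boxSum N a (λ x → V (a ∷ x) * (f (a ∷ x) * U g (a ∷ x)))
      ≡⟨ boxSum-cong N a (λ x _ → trans
           (expandˡ (σ x) (V x) (f (a ∷ x)) (χ (hd x) a) (g (pred a ∷ x)) (U (g ∘ (a ∷_)) x))
           (cong₂ (λ y z → -1ℤ * (V x * (f (a ∷ x) * y)) + z)
                  (sym (U-σ (g ∘ (a ∷_)) x))
                  (σ*σ-cancel x (χ (hd x) a * (V x * (f (a ∷ x) * g (pred a ∷ x))))))) ⟩
    boxSum N a (λ x → -1ℤ * (V x * (f (a ∷ x) * U (λ y → σ y * g (a ∷ y)) x)) +
                      χ (hd x) a * (V x * (f (a ∷ x) * g (pred a ∷ x))))
      ≡⟨ boxSum-lin N a -1ℤ _ _ ⟩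
    -1ℤ * boxSum N a (λ x → V x * (f (a ∷ x) * U (λ y → σ y * g (a ∷ y)) x)) + removed a
      ≡⟨ cong (λ z → -1ℤ * z + removed a)
           (adjoint N a (f ∘ (a ∷_)) (λ y → σ y * g (a ∷ y)) (support a a≤b)) ⟩
    -1ℤ * below a + removed a ∎

  expandʳ : ∀ s v q k p d →
    (s * v) * (q * (k * (s * p) + - d)) ≡ -1ℤ * (v * ((s * q) * d)) + (s * s) * (k * (v * (p * q)))
  expandʳ = solve-∀

  right : ∀ a → boxSum N a (λ x → V (a ∷ x) * (g (a ∷ x) * D b f (a ∷ x)))
              ≡ -1ℤ * below a + χ a b * added a
  right a = begin
    boxSum N a (λ x → V (a ∷ x) * (g (a ∷ x) * D b f (a ∷ x)))
      ≡⟨ boxSum-cong N a (λ x _ → trans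
           (expandʳ (σ x) (V x) (g (a ∷ x)) (χ a b) (f (suc a ∷ x)) (D a (f ∘ (a ∷_)) x))
           (cong (-1ℤ * (V x * ((σ x * g (a ∷ x)) * D a (f ∘ (a ∷_)) x)) +_)
                 (σ*σ-cancel x (χ a b * (V x * (f (suc a ∷ x) * g (a ∷ x))))))) ⟩
    boxSum N a (λ x → -1ℤ * (V x * ((σ x * g (a ∷ x)) * D a (f ∘ (a ∷_)) x)) +
                      χ a b * (V x * (f (suc a ∷ x) * g (a ∷ x))))
      ≡⟨ boxSum-lin N a -1ℤ _ _ ⟩
    -1ℤ * below a + boxSum N a (λ x → χ a b * (V x * (f (suc a ∷ x) * g (a ∷ x))))
      ≡⟨ cong (-1ℤ * below a +_) (boxSum-scale N a (χ a b) _) ⟩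
    -1ℤ * below a + χ a b * added a ∎

VI² : ℕ → Weight
VI² n x = V x * (I n x * I n x)

-- One of the two factors `I (suc n)` is read as `U (I n)` and moved across by adjointness. `n < N`
-- keeps the support within the rows of the box; `n < b` is what `D-I` asks for.
boxSum-VI²-suc : ∀ n {N b} → n < N → n < b →
                 boxSum N b (VI² (suc n)) ≡ parity (suc n) * boxSum N b (VI² n)
boxSum-VI²-suc n {N} {b} n<N n<b = begin
  boxSum N b (VI² (suc n))
    ≡⟨ adjoint N b (I (suc n)) (I n) (inj₂ (λ x N<s → I-vanishes (suc n) x
         (λ e → ℕ.<-irrefl refl (ℕ.≤-<-trans n<N (subst (N <_) e N<s))))) ⟩
  boxSum N b (λ x → V x * (I n x * D b (I (suc n)) x))
    ≡⟨ boxSum-cong N b (λ x dx → trans (cong (λ z → V x * (I n x * z)) (D-I n n<b x dx))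
         (pull (V x) (I n x) (parity (suc n)))) ⟩
  boxSum N b (λ x → parity (suc n) * VI² n x)
    ≡⟨ boxSum-scale N b (parity (suc n)) (VI² n) ⟩
  parity (suc n) * boxSum N b (VI² n) ∎
  where
  open ≡-Reasoning
  pull : ∀ v i p → v * (i * (p * i)) ≡ p * (v * (i * i))
  pull = solve-∀

boxSum-VI² : ∀ n {N b} → suc n < N → suc n < b → boxSum N b (VI² (suc (suc n))) ≡ 0ℤ
boxSum-VI² n {N} {b} n<N n<b = begin
  boxSum N b (VI² (suc (suc n)))
    ≡⟨ boxSum-VI²-suc (suc n) n<N n<b ⟩
  parity (suc (suc n)) * boxSum N b (VI² (suc n))
    ≡⟨ cong (parity (suc (suc n)) *_) (boxSum-VI²-suc n (ℕ.<⇒≤ n<N) (ℕ.<⇒≤ n<b)) ⟩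
  parity (suc (suc n)) * (parity (suc n) * boxSum N b (VI² n))
    ≡⟨ ℤ.*-assoc (parity (suc (suc n))) (parity (suc n)) _ ⟨
  parity (suc (suc n)) * parity (suc n) * boxSum N b (VI² n)
    ≡⟨ cong (_* boxSum N b (VI² n)) (parity-consecutive (suc n)) ⟩
  0ℤ ∎
  where open ≡-Reasoning

-- Integer sums over lists and removable cells

sumℤ-++ : ∀ xs ys → sumℤ (xs ++ ys) ≡ sumℤ xs + sumℤ ys
sumℤ-++ []       ys = sym (ℤ.+-identityˡ (sumℤ ys))
sumℤ-++ (x ∷ xs) ys = trans (cong (x +_) (sumℤ-++ xs ys)) (sym (ℤ.+-assoc x (sumℤ xs) (sumℤ ys)))

sumℤ-scale : ∀ {A : Set} c (f : A → ℤ) xs → sumℤ (map (λ x → c * f x) xs) ≡ c * sumℤ (map f xs)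
sumℤ-scale c f []       = sym (ℤ.*-zeroʳ c)
sumℤ-scale c f (x ∷ xs) = trans (cong (c * f x +_) (sumℤ-scale c f xs))
  (sym (ℤ.*-distribˡ-+ c (f x) (sumℤ (map f xs))))

sumℤ-concatMap : ∀ {A B : Set} (g : B → ℤ) (f : A → List B) xs →
  sumℤ (map g (concatMap f xs)) ≡ sumℤ (map (λ x → sumℤ (map g (f x))) xs)
sumℤ-concatMap g f []       = refl
sumℤ-concatMap g f (x ∷ xs) = begin
  sumℤ (map g (f x ++ concatMap f xs))
    ≡⟨ cong sumℤ (List.map-++ g (f x) (concatMap f xs)) ⟩
  sumℤ (map g (f x) ++ map g (concatMap f xs))
    ≡⟨ sumℤ-++ (map g (f x)) _ ⟩
  sumℤ (map g (f x)) + sumℤ (map g (concatMap f xs))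
    ≡⟨ cong (sumℤ (map g (f x)) +_) (sumℤ-concatMap g f xs) ⟩
  sumℤ (map g (f x)) + sumℤ (map (λ x → sumℤ (map g (f x))) xs) ∎
  where open ≡-Reasoning

-- An emptied row stays as `0`, so a row index means the same before and after the removal.
data Remove : List ℕ → ℕ → List ℕ → Set where
  here  : ∀ {k x} → hd x ≤ k → Remove (suc k ∷ x) 0 (k ∷ x)
  there : ∀ {a x r y} → Remove x r y → Remove (a ∷ x) (suc r) (a ∷ y)

Remove-Decreasing≤ : ∀ {b x r y} → Remove x r y → Decreasing≤ b x → Decreasing≤ b y
Remove-Decreasing≤ (here {x = x} h) (k<b , dx) = ℕ.<⇒≤ k<b , Decreasing≤-tighten x h dx
Remove-Decreasing≤ (there rm)       (a≤b , dx) = a≤b , Remove-Decreasing≤ rm dx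

Remove-sum : ∀ {x r y} → Remove x r y → sum x ≡ suc (sum y)
Remove-sum (here _) = refl
Remove-sum (there {a} {y = y} rm) = trans (cong (a ℕ.+_) (Remove-sum rm)) (ℕ.+-suc a (sum y))

removeTop : ℕ → List ℕ → List (ℕ × List ℕ)
removeTop zero    _ = []
removeTop (suc k) x with hd x ℕ.≤? k
... | yes _ = (0 , k ∷ x) ∷ []
... | no  _ = []

removeBelow : ℕ → ℕ × List ℕ → ℕ × List ℕ
removeBelow a (r , y) = suc r , a ∷ y

removals : List ℕ → List (ℕ × List ℕ)
removals []      = []
removals (a ∷ x) = removeTop a x ++ map (removeBelow a) (removals x)

removeTop-sound : ∀ a x → All (λ (r , y) → Remove (a ∷ x) r y) (removeTop a x)
removeTop-sound zero    x = []
removeTop-sound (suc k) x with hd x ℕ.≤? k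
... | yes h = here h ∷ []
... | no  _ = []

removals-sound : ∀ x → All (λ (r , y) → Remove x r y) (removals x)
removals-sound []      = []
removals-sound (a ∷ x) = All.++⁺ (removeTop-sound a x) (All.map⁺ (All.map there (removals-sound x)))

removals-complete : ∀ {x r y} → Remove x r y → (r , y) ∈ removals x
removals-complete (here {k} {x} h) = ∈-++⁺ˡ top
  where
  top : (0 , k ∷ x) ∈ removeTop (suc k) x
  top with hd x ℕ.≤? k
  ... | yes _ = here refl
  ... | no ¬h = contradiction h ¬h
removals-complete (there {a} {x} rm) =
  ∈-++⁺ʳ (removeTop a x) (∈-map⁺ (removeBelow a) (removals-complete rm))

-- Tableaux built from different removals will be told apart by the row of the largest entry.
removals-rows : ∀ x → AllPairs (λ p q → proj₁ p ≢ proj₁ q) (removals x)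
removals-rows []      = []
removals-rows (a ∷ x) = top a
  where
  rest : AllPairs (λ p q → proj₁ p ≢ proj₁ q) (map (removeBelow a) (removals x))
  rest = AllPairs.map⁺ (AllPairs.map (λ r≢r′ → r≢r′ ∘ ℕ.suc-injective) (removals-rows x))
  top : ∀ b → AllPairs (λ p q → proj₁ p ≢ proj₁ q) (removeTop b x ++ map (removeBelow a) (removals x))
  top zero    = rest
  top (suc k) with hd x ℕ.≤? k
  ... | yes _ = All.map⁺ (All.universal (λ _ ()) (removals x)) ∷ rest
  ... | no  _ = rest

U-removals : ∀ f x → sumℤ (map (λ (r , y) → (-1ℤ ^ℤ sum (drop (suc r) x)) * f y) (removals x)) ≡ U f x
U-removals f []      = refl
U-removals f (a ∷ x) = begin
  sumℤ (map term (removeTop a x ++ map (removeBelow a) (removals x)))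
    ≡⟨ cong sumℤ (List.map-++ term (removeTop a x) _) ⟩
  sumℤ (map term (removeTop a x) ++ map term (map (removeBelow a) (removals x)))
    ≡⟨ sumℤ-++ (map term (removeTop a x)) _ ⟩
  sumℤ (map term (removeTop a x)) + sumℤ (map term (map (removeBelow a) (removals x)))
    ≡⟨ cong₂ _+_ (top a) (trans (cong sumℤ (sym (List.map-∘ (removals x)))) (U-removals (f ∘ (a ∷_)) x)) ⟩
  U f (a ∷ x) ∎
  where
  open ≡-Reasoning
  term : ℕ × List ℕ → ℤ
  term (r , y) = (-1ℤ ^ℤ sum (drop (suc r) (a ∷ x))) * f y
  one : ∀ p → p + 0ℤ ≡ 1ℤ * p
  one = solve-∀
  top : ∀ b → sumℤ (map term (removeTop b x)) ≡ χ (hd x) b * (σ x * f (pred b ∷ x))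
  top zero    = refl
  top (suc k) with hd x ℕ.≤? k
  ... | yes h rewrite χ-< (s≤s h)        = one (σ x * f (k ∷ x))
  ... | no ¬h rewrite χ-≥ (ℕ.≰⇒> ¬h) = refl

-- Inserting and deleting the largest entry of a tableau

appendAt : ℕ → ℕ → Tableau → Tableau
appendAt _       m []      = []
appendAt zero    m (R ∷ T) = (R ∷ʳ m) ∷ T
appendAt (suc r) m (R ∷ T) = R ∷ appendAt r m T

top : Tableau → List ℕ
top []      = []
top (R ∷ _) = R

hd≡length-top : ∀ {x} T → map length T ≡ x → hd x ≡ length (top T)
hd≡length-top []      refl = refl
hd≡length-top (_ ∷ _) refl = refl

link : ∀ R T → Above R (top T) → Linked Above T → Linked Above (R ∷ T)
link R []      _ _ = [-]
link R (_ ∷ _) a l = a ∷ l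

unlink : ∀ R T → Linked Above (R ∷ T) → Above R (top T) × Linked Above T
unlink R []      [-]     = _ , []
unlink R (_ ∷ _) (a ∷ l) = a , l

Above-∷ʳˡ : ∀ m xs ys → Above xs ys → Above (xs ∷ʳ m) ys
Above-∷ʳˡ m xs       []       _       = _
Above-∷ʳˡ m (x ∷ xs) (y ∷ ys) (p , a) = p , Above-∷ʳˡ m xs ys a

Above-∷ʳʳ : ∀ {m} xs ys → All (_< m) xs → length ys < length xs → Above xs ys → Above xs (ys ∷ʳ m)
Above-∷ʳʳ (x ∷ xs) []       (p ∷ _)  _         _       = p , _
Above-∷ʳʳ (x ∷ xs) (y ∷ ys) (_ ∷ ps) (s≤s len) (p , a) = p , Above-∷ʳʳ xs ys ps len a

Above-init : ∀ {m} xs ys → Above xs (ys ∷ʳ m) → Above xs ys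
Above-init xs       []       _       = _
Above-init (x ∷ xs) (y ∷ ys) (p , a) = p , Above-init xs ys a

-- An entry below the maximum m would exceed m.
Above-dropMax : ∀ {m} xs ys → All (_≤ m) ys → Above (xs ∷ʳ m) ys → Above xs ys × length ys ≤ length xs
Above-dropMax xs       []       _        _       = _ , z≤n
Above-dropMax []       (y ∷ ys) (p ∷ _)  (q , _) = contradiction q (ℕ.≤⇒≯ p)
Above-dropMax (x ∷ xs) (y ∷ ys) (_ ∷ ps) (q , a) =
  let a′ , len = Above-dropMax xs ys ps a in (q , a′) , s≤s len

increasing-∷ʳ : ∀ {m} R → Linked _<_ R → All (_< m) R → Linked _<_ (R ∷ʳ m)
increasing-∷ʳ []          _       _        = [-]
increasing-∷ʳ (x ∷ [])    _       (p ∷ _)  = p ∷ [-]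
increasing-∷ʳ (x ∷ y ∷ R) (q ∷ l) (_ ∷ ps) = q ∷ increasing-∷ʳ (y ∷ R) l ps

increasing-init : ∀ {m} R → Linked _<_ (R ∷ʳ m) → Linked _<_ R
increasing-init []          _       = []
increasing-init (x ∷ [])    _       = [-]
increasing-init (x ∷ y ∷ R) (q ∷ l) = q ∷ increasing-init (y ∷ R) l

max-last : ∀ {m} R → Linked _<_ R → All (_≤ m) R → m ∈ R → ∃[ R₀ ] R ≡ R₀ ∷ʳ m
max-last (x ∷ [])    _       _            (here refl) = [] , refl
max-last (x ∷ y ∷ R) (q ∷ _) (_ ∷ p ∷ _)  (here refl) = contradiction q (ℕ.≤⇒≯ p)
max-last (x ∷ y ∷ R) (_ ∷ l) (_ ∷ ps)     (there m∈R) =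
  let R₀ , e = max-last (y ∷ R) l ps m∈R in x ∷ R₀ , cong (x ∷_) e

length-∷ʳ : ∀ (R : List ℕ) m → length (R ∷ʳ m) ≡ suc (length R)
length-∷ʳ R m = trans (List.length-++ R) (ℕ.+-comm (length R) 1)

-- The part of `IsSYT` that does not mention the set of entries; that set changes with each
-- insertion and is tracked by permutations instead.
Rows : List ℕ → Tableau → Set
Rows x T = map length T ≡ x × All (Linked _<_) T × Linked Above T

appendAt-Rows : ∀ {b m x r y} T → Remove x r y → Decreasing≤ b x → All (All (_< m)) T →
                Rows y T → Rows x (appendAt r m T)
appendAt-Rows {m = m} (R ∷ T) (here {k} h) dx (p ∷ ps) (refl , l ∷ ls , ab) =
  let a , as = unlink R T ab in
  cong (_∷ map length T) (length-∷ʳ R m) ,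
  increasing-∷ʳ R l p ∷ ls ,
  link (R ∷ʳ m) T (Above-∷ʳˡ m R (top T) a) as
appendAt-Rows {m = m} (R ∷ T) (there {r = r} rm) (_ , dx) (p ∷ ps) (refl , l ∷ ls , ab) =
  let a , as = unlink R T ab
      eq , ls′ , as′ = appendAt-Rows T rm dx ps (refl , ls , as)
  in cong (length R ∷_) eq , l ∷ ls′ , link R (appendAt r m T) (above T rm dx a) as′
  where
  -- The new entry needs a neighbour above it: the lengthened row still fits under `R` because `x`
  -- is decreasing.
  above : ∀ T {r x} → Remove x r (map length T) → Decreasing≤ (length R) x →
          Above R (top T) → Above R (top (appendAt r m T))
  above (S ∷ T) (here _)  (len , _) a = Above-∷ʳʳ R S p len a
  above (S ∷ T) (there _) _         a = a

unappend : ∀ {m x} T → All (All (_≤ m)) T → Rows x T → m ∈ concat T →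
           ∃[ r ] ∃[ y ] ∃[ S ] Remove x r y × Rows y S × T ≡ appendAt r m S
unappend (R ∷ T) (p ∷ ps) (refl , l ∷ ls , ab) m∈ with ∈-++⁻ R m∈ | unlink R T ab
... | inj₁ m∈R | a , as with max-last R l p m∈R
... | R₀ , refl =
  let a′ , len = Above-dropMax R₀ (top T) (top-All T ps) a in
  0 , length R₀ ∷ map length T , R₀ ∷ T ,
  subst (λ k → Remove (k ∷ map length T) 0 (length R₀ ∷ map length T)) (sym (length-∷ʳ R₀ _))
    (here (subst (_≤ length R₀) (sym (hd≡length-top T refl)) len)) ,
  (refl , increasing-init R₀ l ∷ ls , link R₀ T a′ as) ,
  refl
  where
  top-All : ∀ {m} T → All (All (_≤ m)) T → All (_≤ m) (top T)
  top-All []      _       = []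
  top-All (_ ∷ _) (p ∷ _) = p
unappend (R ∷ T) (p ∷ ps) (refl , l ∷ ls , ab) m∈ | inj₂ m∈T | a , as
  with unappend T ps (refl , ls , as) m∈T
... | r , y , S , rm , (eq , ls′ , as′) , refl =
  suc r , length R ∷ y , R ∷ S , there rm ,
  (cong (length R ∷_) eq , l ∷ ls′ , link R S (above S r a) as′) ,
  refl
  where
  above : ∀ {m} S r → Above R (top (appendAt r m S)) → Above R (top S)
  above []      _       a = _
  above (Q ∷ S) zero    a = Above-init R Q a
  above (Q ∷ S) (suc r) a = a

-- Neither tableau contains `m` beforehand, so the row holding `m` reveals the index, and dropping
-- its last entry recovers the tableau.
appendAt-injective : ∀ {m x r r′ y y′} S S′ → Remove x r y → Remove x r′ y′ →
  map length S ≡ y → map length S′ ≡ y′ → All (All (_< m)) S → All (All (_< m)) S′ →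
  appendAt r m S ≡ appendAt r′ m S′ → r ≡ r′ × S ≡ S′
appendAt-injective (R ∷ S) (R′ ∷ S′) (here _) (here _) _ _ _ _ e =
  refl , cong₂ _∷_ (proj₁ (List.∷ʳ-injective R R′ (List.∷-injectiveˡ e))) (List.∷-injectiveʳ e)
appendAt-injective {m} (R ∷ S) (R′ ∷ S′) (here _) (there _) _ _ _ (p ∷ _) e =
  contradiction (All.lookup p (subst (m ∈_) (List.∷-injectiveˡ e) (∈-++⁺ʳ R (here refl)))) (ℕ.<-irrefl refl)
appendAt-injective {m} (R ∷ S) (R′ ∷ S′) (there _) (here _) _ _ (p ∷ _) _ e =
  contradiction (All.lookup p (subst (m ∈_) (sym (List.∷-injectiveˡ e)) (∈-++⁺ʳ R′ (here refl)))) (ℕ.<-irrefl refl)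
appendAt-injective (R ∷ S) (R′ ∷ S′) (there rm) (there rm′) l l′ (_ ∷ ps) (_ ∷ ps′) e
  with appendAt-injective S S′ rm rm′ (List.∷-injectiveʳ l) (List.∷-injectiveʳ l′) ps ps′ (List.∷-injectiveʳ e)
... | refl , refl = refl , cong (_∷ S) (List.∷-injectiveˡ e)

length-concat : ∀ (T : Tableau) → length (concat T) ≡ sum (map length T)
length-concat []      = refl
length-concat (R ∷ T) = trans (List.length-++ R) (cong (length R ℕ.+_) (length-concat T))

-- The suffix `w` is made of the rows below the insertion; its length is the exponent in the sign of
-- `U`.
appendAt-word : ∀ {m x r y} S → Remove x r y → map length S ≡ y →
  ∃[ u ] ∃[ w ] concat (appendAt r m S) ≡ u ++ m ∷ w × concat S ≡ u ++ w × length w ≡ sum (drop (suc r) x)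
appendAt-word {m} (R ∷ S) (here _) refl =
  R , concat S , List.++-assoc R (m ∷ []) (concat S) , refl , length-concat S
appendAt-word (R ∷ S) (there rm) l with appendAt-word S rm (List.∷-injectiveʳ l)
... | u , w , e , e′ , len =
  R ++ u , w , trans (cong (R ++_) e) (sym (List.++-assoc R u _)) ,
  trans (cong (R ++_) e′) (sym (List.++-assoc R u w)) , len

appendAt-↭ : ∀ {m x r y} S → Remove x r y → map length S ≡ y → concat (appendAt r m S) ↭ m ∷ concat S
appendAt-↭ {m} S rm l =
  let u , w , e , e′ , _ = appendAt-word S rm l
  in ↭-trans (↭-reflexive e) (↭-trans (↭.shift m u w) (↭-reflexive (cong (m ∷_) (sym e′))))

-- A maximum is inverted with every later letter and with no earlier one.
inversions-max : ∀ {m} u w → All (_< m) (u ++ w) → inversions (u ++ m ∷ w) ≡ length w ℕ.+ inversions (u ++ w)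
inversions-max {m} []      w ps       = cong (λ z → length z ℕ.+ inversions w) (List.filter-all (_<? m) ps)
inversions-max {m} (x ∷ u) w (p ∷ ps) = begin
  length (filter (_<? x) (u ++ m ∷ w)) ℕ.+ inversions (u ++ m ∷ w)
    ≡⟨ cong₂ ℕ._+_ (cong length smaller) (inversions-max u w ps) ⟩
  c ℕ.+ (length w ℕ.+ inversions (u ++ w))
    ≡⟨ ℕ.+-assoc c (length w) _ ⟨
  c ℕ.+ length w ℕ.+ inversions (u ++ w)
    ≡⟨ cong (ℕ._+ inversions (u ++ w)) (ℕ.+-comm c (length w)) ⟩
  length w ℕ.+ c ℕ.+ inversions (u ++ w)
    ≡⟨ ℕ.+-assoc (length w) c _ ⟩
  length w ℕ.+ (c ℕ.+ inversions (u ++ w)) ∎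
  where
  open ≡-Reasoning
  c : ℕ
  c = length (filter (_<? x) (u ++ w))
  smaller : filter (_<? x) (u ++ m ∷ w) ≡ filter (_<? x) (u ++ w)
  smaller = begin
    filter (_<? x) (u ++ m ∷ w)                       ≡⟨ List.filter-++ (_<? x) u (m ∷ w) ⟩
    filter (_<? x) u ++ filter (_<? x) (m ∷ w)
      ≡⟨ cong (filter (_<? x) u ++_) (List.filter-reject (_<? x) (ℕ.<⇒≯ p)) ⟩
    filter (_<? x) u ++ filter (_<? x) w              ≡⟨ List.filter-++ (_<? x) u w ⟨
    filter (_<? x) (u ++ w)                           ∎

sgnT-appendAt : ∀ {m x r y} S → Remove x r y → map length S ≡ y → All (_< m) (concat S) →
                sgnT (appendAt r m S) ≡ (-1ℤ ^ℤ sum (drop (suc r) x)) * sgnT S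
sgnT-appendAt {m} {x} {r} S rm l ps with appendAt-word S rm l
... | u , w , e , e′ , len = begin
  -1ℤ ^ℤ inversions (concat (appendAt r m S))
    ≡⟨ cong (λ z → -1ℤ ^ℤ inversions z) e ⟩
  -1ℤ ^ℤ inversions (u ++ m ∷ w)
    ≡⟨ cong (-1ℤ ^ℤ_) (inversions-max u w (subst (All (_< m)) e′ ps)) ⟩
  -1ℤ ^ℤ (length w ℕ.+ inversions (u ++ w))
    ≡⟨ cong₂ (λ k z → -1ℤ ^ℤ (k ℕ.+ inversions z)) len (sym e′) ⟩
  -1ℤ ^ℤ (sum (drop (suc r) x) ℕ.+ inversions (concat S))
    ≡⟨ ℤ.^-distribˡ-+-* -1ℤ (sum (drop (suc r) x)) (inversions (concat S)) ⟩
  (-1ℤ ^ℤ sum (drop (suc r) x)) * sgnT S ∎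
  where open ≡-Reasoning

-- Enumeration of standard Young tableaux

entries : ℕ → List ℕ
entries n = map suc (upTo n)

entries-suc : ∀ n → entries (suc n) ↭ suc n ∷ entries n
entries-suc n = ↭-trans
  (↭-reflexive (trans (cong (map suc) (sym (List.upTo-∷ʳ n))) (List.map-++ suc (upTo n) (n ∷ []))))
  (↭-sym (↭.∷↭∷ʳ (suc n) (entries n)))

entries-< : ∀ n → All (_< suc n) (entries n)
entries-< n = All.map⁺ (All.tabulate (λ i∈ → s≤s (∈-upTo⁻ i∈)))

emptyRows : List ℕ → Tableau
emptyRows = map (λ _ → [])

-- At size 0 the shape may still list rows emptied by removals, hence `emptyRows x` in place of
-- `[]`.
tableaux : ℕ → List ℕ → List Tableau
tableaux zero    x = emptyRows x ∷ []
tableaux (suc n) x = concatMap (λ (r , y) → map (appendAt r (suc n)) (tableaux n y)) (removals x)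

concat-emptyRows : ∀ x → concat (emptyRows x) ≡ []
concat-emptyRows []      = refl
concat-emptyRows (_ ∷ x) = concat-emptyRows x

empty-IsSYT : ∀ x → sum x ≡ 0 → IsSYT x (emptyRows x)
empty-IsSYT x s≡0 = lengths x s≡0 , word , All.map⁺ (All.universal (λ _ → []) x) , linked x
  where
  lengths : ∀ x → sum x ≡ 0 → map length (emptyRows x) ≡ x
  lengths []         _ = refl
  lengths (zero ∷ x) e = cong (0 ∷_) (lengths x e)
  word : concat (emptyRows x) ↭ entries (sum x)
  word rewrite s≡0 = ↭-reflexive (concat-emptyRows x)
  linked : ∀ x → Linked Above (emptyRows x)
  linked []          = []
  linked (_ ∷ [])    = [-]
  linked (_ ∷ y ∷ x) = tt ∷ linked (y ∷ x)

all-empty : ∀ x T → sum x ≡ 0 → map length T ≡ x → T ≡ emptyRows x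
all-empty .[]      []       _ refl = refl
all-empty _ ([] ∷ T) e refl = cong ([] ∷_) (all-empty _ T e refl)

IsSYT-< : ∀ {n x T} → sum x ≡ n → IsSYT x T → All (_< suc n) (concat T)
IsSYT-< refl (_ , w , _) = ↭.All-resp-↭ (↭-sym w) (entries-< _)

tableaux-sound : ∀ n {b} x → Decreasing≤ b x → sum x ≡ n → ∀ {T} → T ∈ tableaux n x → IsSYT x T
tableaux-sound zero    x dx s≡n (here refl) = empty-IsSYT x s≡n
tableaux-sound (suc n) x dx s≡n T∈ with find (∈-concatMap⁻ _ {xs = removals x} T∈)
... | (r , y) , ry∈ , T∈′ with ∈-map⁻ (appendAt r (suc n)) T∈′
... | S , S∈ , refl =
  let rm  = All.lookup (removals-sound x) ry∈
      s≡n′ = ℕ.suc-injective (trans (sym (Remove-sum rm)) s≡n)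
      syt@(len , w , ls , as) = tableaux-sound n y (Remove-Decreasing≤ rm dx) s≡n′ S∈
      len′ , ls′ , as′ = appendAt-Rows S rm dx (All.concat⁻ (IsSYT-< s≡n′ syt)) (len , ls , as)
  in len′ ,
     ↭-trans (appendAt-↭ S rm len)
       (↭-trans (prep (suc n) (subst (λ k → concat S ↭ entries k) s≡n′ w))
         (↭-trans (↭-sym (entries-suc n)) (↭-reflexive (cong entries (sym s≡n))))) ,
     ls′ , as′

tableaux-complete : ∀ n x → sum x ≡ n → ∀ T → IsSYT x T → T ∈ tableaux n x
tableaux-complete zero    x s≡n T (len , _) = here (all-empty x T s≡n len)
tableaux-complete (suc n) x s≡n T syt@(len , w , ls , as) =
  result (unappend T bound (len , ls , as) (↭.∈-resp-↭ (↭-sym w′) (here refl)))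
  where
  w′ : concat T ↭ suc n ∷ entries n
  w′ = ↭-trans w (↭-trans (↭-reflexive (cong entries s≡n)) (entries-suc n))
  bound : All (All (_≤ suc n)) T
  bound = All.concat⁻ (All.map ℕ.≤-pred (IsSYT-< s≡n syt))
  result : ∃[ r ] ∃[ y ] ∃[ S ] Remove x r y × Rows y S × T ≡ appendAt r (suc n) S → T ∈ tableaux (suc n) x
  result (r , y , S , rm , (len , ls , as) , refl) =
    ∈-concatMap⁺ _ (lose (removals-complete rm) (∈-map⁺ (appendAt r (suc n))
      (tableaux-complete n y s≡n′ S
        (len , subst (λ k → concat S ↭ entries k) (sym s≡n′)
                 (↭.drop-∷ (↭-trans (↭-sym (appendAt-↭ S rm len)) w′)) , ls , as))))
    where
    s≡n′ : sum y ≡ n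
    s≡n′ = ℕ.suc-injective (trans (sym (Remove-sum rm)) s≡n)

tableaux-unique : ∀ n {b} x → Decreasing≤ b x → sum x ≡ n → Unique (tableaux n x)
tableaux-unique zero    x dx s≡n = [] ∷ []
tableaux-unique (suc n) x dx s≡n = concatMap-unique (removals x) (removals-sound x) (removals-rows x)
  where
  f : ℕ × List ℕ → List Tableau
  f (r , y) = map (appendAt r (suc n)) (tableaux n y)

  appended-injective : ∀ {r r′ y y′ S S′} → Remove x r y → Remove x r′ y′ →
    S ∈ tableaux n y → S′ ∈ tableaux n y′ →
    appendAt r (suc n) S ≡ appendAt r′ (suc n) S′ → r ≡ r′ × S ≡ S′
  appended-injective {S = S} {S′} rm rm′ S∈ S′∈ =
    let s≡n₁ , syt₁ = standard rm S∈
        s≡n₂ , syt₂ = standard rm′ S′∈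
    in appendAt-injective S S′ rm rm′ (proj₁ syt₁) (proj₁ syt₂)
         (All.concat⁻ (IsSYT-< s≡n₁ syt₁)) (All.concat⁻ (IsSYT-< s≡n₂ syt₂))
    where
    standard : ∀ {r y S} → Remove x r y → S ∈ tableaux n y → sum y ≡ n × IsSYT y S
    standard {y = y} rm S∈ =
      let s≡n′ = ℕ.suc-injective (trans (sym (Remove-sum rm)) s≡n)
      in s≡n′ , tableaux-sound n y (Remove-Decreasing≤ rm dx) s≡n′ S∈

  map-unique : ∀ {A B : Set} (g : A → B) xs → (∀ {u v} → u ∈ xs → v ∈ xs → g u ≡ g v → u ≡ v) →
               Unique xs → Unique (map g xs)
  map-unique g []       _   _          = []
  map-unique g (u ∷ xs) inj (u∉ ∷ xs!) =
    All.map⁺ (All.tabulate (λ v∈ e → All.lookup u∉ v∈ (inj (here refl) (there v∈) e))) ∷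
    map-unique g xs (λ u∈ v∈ → inj (there u∈) (there v∈)) xs!

  concatMap-unique : ∀ ps → All (λ (r , y) → Remove x r y) ps →
    AllPairs (λ p q → proj₁ p ≢ proj₁ q) ps → Unique (concatMap f ps)
  concatMap-unique []             _          _            = []
  concatMap-unique ((r , y) ∷ ps) (rm ∷ rms) (r∉ ∷ rows) =
    Unique.++⁺
      (map-unique (appendAt r (suc n)) (tableaux n y)
        (λ S∈ S′∈ e → proj₂ (appended-injective rm rm S∈ S′∈ e))
        (tableaux-unique n y (Remove-Decreasing≤ rm dx)
          (ℕ.suc-injective (trans (sym (Remove-sum rm)) s≡n))))
      (concatMap-unique ps rms rows)
      disjoint
    where
    disjoint : ∀ {T} → T ∈ f (r , y) × T ∈ concatMap f ps → ⊥
    disjoint (T∈₁ , T∈₂) with find (∈-concatMap⁻ f {xs = ps} T∈₂)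
    ... | (r′ , y′) , q∈ , T∈′ with ∈-map⁻ (appendAt r (suc n)) T∈₁ | ∈-map⁻ (appendAt r′ (suc n)) T∈′
    ... | S , S∈ , refl | S′ , S′∈ , e =
      All.lookup r∉ q∈ (proj₁ (appended-injective rm (All.lookup rms q∈) S∈ S′∈ e))

tableaux-enumerates : ∀ n {b} x → Decreasing≤ b x → sum x ≡ n → Enumerates (IsSYT x) (tableaux n x)
tableaux-enumerates n x dx s≡n = tableaux-unique n x dx s≡n ,
  λ T → mk⇔ (tableaux-sound n x dx s≡n) (tableaux-complete n x s≡n T)

imbalance : ∀ n {b} x → Decreasing≤ b x → sum x ≡ n → sumℤ (map sgnT (tableaux n x)) ≡ I n x
imbalance zero    x dx s≡n rewrite s≡n = cong (λ w → sgnWord w + 0ℤ) (concat-emptyRows x)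
imbalance (suc n) x dx s≡n = begin
  sumℤ (map sgnT (tableaux (suc n) x))
    ≡⟨ sumℤ-concatMap sgnT _ (removals x) ⟩
  sumℤ (map (λ (r , y) → sumℤ (map sgnT (map (appendAt r (suc n)) (tableaux n y)))) (removals x))
    ≡⟨ cong sumℤ (List.map-cong-local (All.map term (removals-sound x))) ⟩
  sumℤ (map (λ (r , y) → (-1ℤ ^ℤ sum (drop (suc r) x)) * I n y) (removals x))
    ≡⟨ U-removals (I n) x ⟩
  U (I n) x ∎
  where
  open ≡-Reasoning
  term : ∀ {(r , y) : ℕ × List ℕ} → Remove x r y →
    sumℤ (map sgnT (map (appendAt r (suc n)) (tableaux n y))) ≡ (-1ℤ ^ℤ sum (drop (suc r) x)) * I n y
  term {r , y} rm = begin
    sumℤ (map sgnT (map (appendAt r (suc n)) (tableaux n y)))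
      ≡⟨ cong sumℤ (List.map-∘ (tableaux n y)) ⟨
    sumℤ (map (sgnT ∘ appendAt r (suc n)) (tableaux n y))
      ≡⟨ cong sumℤ (List.map-cong-local (All.tabulate sign)) ⟩
    sumℤ (map (λ S → (-1ℤ ^ℤ sum (drop (suc r) x)) * sgnT S) (tableaux n y))
      ≡⟨ sumℤ-scale (-1ℤ ^ℤ sum (drop (suc r) x)) sgnT (tableaux n y) ⟩
    (-1ℤ ^ℤ sum (drop (suc r) x)) * sumℤ (map sgnT (tableaux n y))
      ≡⟨ cong ((-1ℤ ^ℤ sum (drop (suc r) x)) *_) (imbalance n y dy s≡n′) ⟩
    (-1ℤ ^ℤ sum (drop (suc r) x)) * I n y ∎
    where
    dy = Remove-Decreasing≤ rm dx
    s≡n′ : sum y ≡ n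
    s≡n′ = ℕ.suc-injective (trans (sym (Remove-sum rm)) s≡n)
    sign : ∀ {S} → S ∈ tableaux n y → sgnT (appendAt r (suc n) S) ≡ (-1ℤ ^ℤ sum (drop (suc r) x)) * sgnT S
    sign {S} S∈ =
      let syt = tableaux-sound n y dy s≡n′ S∈
      in sgnT-appendAt S rm (proj₁ syt) (IsSYT-< s≡n′ syt)

-- Independence of the enumeration; partitions inside a box

sumℤ-↭ : ∀ {xs ys} → xs ↭ ys → sumℤ xs ≡ sumℤ ys
sumℤ-↭ = foldr-commMonoid ℤ.+-0-isCommutativeMonoid ∘ ↭⇒↭ₛ

-- The theorem allows arbitrary enumerations; duplicate-free lists with the same members agree as
-- bags, so a concrete enumeration may replace any given one.
enumerations-↭ : ∀ {A : Set} {P : A → Set} {xs ys} → Enumerates P xs → Enumerates P ys → xs ↭ ys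
enumerations-↭ (xs! , xs⇔) (ys! , ys⇔) = ∼bag⇒↭ (unique∧set⇒bag xs! ys!
  (λ {x} → mk⇔ (λ x∈ → Equivalence.from (ys⇔ x) (Equivalence.to (xs⇔ x) x∈))
               (λ x∈ → Equivalence.from (xs⇔ x) (Equivalence.to (ys⇔ x) x∈))))

sum-enumeration : ∀ {A : Set} {P : A → Set} (f : A → ℤ) {xs ys} →
  Enumerates P xs → Enumerates P ys → sumℤ (map f xs) ≡ sumℤ (map f ys)
sum-enumeration f ex ey = sumℤ-↭ (↭.map⁺ f (enumerations-↭ ex ey))

box : ℕ → ℕ → List (List ℕ)
box zero    _       = [] ∷ []
box (suc N) zero    = [] ∷ []
box (suc N) (suc b) = box (suc N) b ++ map (suc b ∷_) (box N (suc b))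

boxSum₀ : ∀ N f → IgnoresFinalZero f → boxSum N 0 f ≡ f []
boxSum₀ zero    f fz = refl
boxSum₀ (suc N) f fz = trans (boxSum₀ N (f ∘ (0 ∷_)) (fz ∘ (0 ∷_))) (fz [])

-- `boxSum` pads every shape of `box` with empty rows up to `N` rows, and such a weight cannot see
-- the padding.
sum-box : ∀ N b f → IgnoresFinalZero f → sumℤ (map f (box N b)) ≡ boxSum N b f
sum-box zero    b       f fz = ℤ.+-identityʳ (f [])
sum-box (suc N) zero    f fz = trans (ℤ.+-identityʳ (f [])) (sym (boxSum₀ (suc N) f fz))
sum-box (suc N) (suc b) f fz = begin
  sumℤ (map f (box (suc N) b ++ map (suc b ∷_) (box N (suc b))))
    ≡⟨ cong sumℤ (List.map-++ f (box (suc N) b) _) ⟩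
  sumℤ (map f (box (suc N) b) ++ map f (map (suc b ∷_) (box N (suc b))))
    ≡⟨ sumℤ-++ (map f (box (suc N) b)) _ ⟩
  sumℤ (map f (box (suc N) b)) + sumℤ (map f (map (suc b ∷_) (box N (suc b))))
    ≡⟨ cong₂ _+_ (sum-box (suc N) b f fz)
         (trans (cong sumℤ (sym (List.map-∘ (box N (suc b)))))
                (sum-box N (suc b) (f ∘ (suc b ∷_)) (fz ∘ (suc b ∷_)))) ⟩
  boxSum (suc N) (suc b) f ∎
  where open ≡-Reasoning

box-sound : ∀ N b {x} → x ∈ box N b → All (1 ≤_) x × Decreasing≤ b x
box-sound zero    b       (here refl) = [] , _
box-sound (suc N) zero    (here refl) = [] , _
box-sound (suc N) (suc b) x∈ with ∈-++⁻ (box (suc N) b) x∈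
... | inj₁ x∈ˡ =
  let pos , dx = box-sound (suc N) b x∈ˡ in pos , weaken _ dx
  where
  weaken : ∀ x → Decreasing≤ b x → Decreasing≤ (suc b) x
  weaken []      _          = _
  weaken (a ∷ x) (a≤b , dx) = ℕ.m≤n⇒m≤1+n a≤b , dx
... | inj₂ x∈ʳ with ∈-map⁻ (suc b ∷_) x∈ʳ
... | y , y∈ , refl = let pos , dy = box-sound N (suc b) y∈ in s≤s z≤n ∷ pos , ℕ.≤-refl , dy

box-complete : ∀ N b {x} → All (1 ≤_) x → Decreasing≤ b x → length x ≤ N → x ∈ box N b
box-complete zero    b       []      _         _       = here refl
box-complete (suc N) zero    []      _         _       = here refl
box-complete (suc N) zero    (() ∷ _) (z≤n , _) _
box-complete (suc N) (suc b) []      _         _       = ∈-++⁺ˡ (box-complete (suc N) b [] _ z≤n)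
box-complete (suc N) (suc b) {a ∷ x} (p ∷ ps) (a≤ , dx) len@(s≤s len′) with ℕ.m≤n⇒m<n∨m≡n a≤
... | inj₁ (s≤s a≤b) = ∈-++⁺ˡ (box-complete (suc N) b (p ∷ ps) (a≤b , dx) len)
... | inj₂ refl      = ∈-++⁺ʳ (box (suc N) b) (∈-map⁺ (suc b ∷_) (box-complete N (suc b) ps dx len′))

box-unique : ∀ N b → Unique (box N b)
box-unique zero    b       = [] ∷ []
box-unique (suc N) zero    = [] ∷ []
box-unique (suc N) (suc b) = Unique.++⁺ (box-unique (suc N) b)
  (Unique.map⁺ List.∷-injectiveʳ (box-unique N (suc b))) disjoint
  where
  disjoint : ∀ {x} → x ∈ box (suc N) b × x ∈ map (suc b ∷_) (box N (suc b)) → ⊥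
  disjoint (x∈ , x∈′) with ∈-map⁻ (suc b ∷_) x∈′
  ... | _ , _ , refl = ℕ.<-irrefl refl (proj₁ (proj₂ (box-sound (suc N) b x∈)))

Linked⇒Decreasing≤ : ∀ {b} x → hd x ≤ b → Linked _≥_ x → Decreasing≤ b x
Linked⇒Decreasing≤ []          _   _       = _
Linked⇒Decreasing≤ (a ∷ [])    a≤b _       = a≤b , _
Linked⇒Decreasing≤ (a ∷ c ∷ x) a≤b (p ∷ l) = a≤b , Linked⇒Decreasing≤ (c ∷ x) p l

Decreasing≤⇒Linked : ∀ {b} x → Decreasing≤ b x → Linked _≥_ x
Decreasing≤⇒Linked []          _             = []
Decreasing≤⇒Linked (a ∷ [])    _             = [-]
Decreasing≤⇒Linked (a ∷ c ∷ x) (_ , p , dx) = p ∷ Decreasing≤⇒Linked (c ∷ x) (p , dx)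

length≤sum : ∀ {x} → All (1 ≤_) x → length x ≤ sum x
length≤sum []       = z≤n
length≤sum (p ∷ ps) = ℕ.+-mono-≤ p (length≤sum ps)

partition-Decreasing≤ : ∀ {n x} → IsPartition n x → Decreasing≤ n x
partition-Decreasing≤ {x = x} (_ , l , refl) = Linked⇒Decreasing≤ x (hd≤sum x) l

partitions : ℕ → List (List ℕ)
partitions n = filter (λ x → sum x ℕ.≟ n) (box n n)

partitions-enumerates : ∀ n → Enumerates (IsPartition n) (partitions n)
partitions-enumerates n = Unique.filter⁺ _ (box-unique n n) , λ x → mk⇔ to from
  where
  to : ∀ {x} → x ∈ partitions n → IsPartition n x
  to {x} x∈ =
    let x∈box , s≡n = ∈-filter⁻ (λ x → sum x ℕ.≟ n) {xs = box n n} x∈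
        pos , dx = box-sound n n x∈box
    in pos , Decreasing≤⇒Linked x dx , s≡n
  from : ∀ {x} → IsPartition n x → x ∈ partitions n
  from p@(pos , _ , s≡n) = ∈-filter⁺ (λ x → sum x ℕ.≟ n)
    (box-complete n n pos (partition-Decreasing≤ p) (subst (_ ≤_) s≡n (length≤sum pos))) s≡n

-- Extends the sum from the partitions of n to the whole box, as `VI² n` vanishes at all other
-- sizes.
sumℤ-filter : ∀ {A : Set} {P : A → Set} (P? : Decidable P) (f : A → ℤ) →
  (∀ x → ¬ P x → f x ≡ 0ℤ) → ∀ xs → sumℤ (map f (filter P? xs)) ≡ sumℤ (map f xs)
sumℤ-filter P? f f0 []       = refl
sumℤ-filter P? f f0 (x ∷ xs) with P? x
... | yes _  = cong (f x +_) (sumℤ-filter P? f f0 xs)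
... | no ¬px rewrite f0 x ¬px = trans (sumℤ-filter P? f f0 xs) (sym (ℤ.+-identityˡ _))

V-ignoresFinalZero : IgnoresFinalZero V
V-ignoresFinalZero []      = refl
V-ignoresFinalZero (a ∷ x) = cong₂ _*_ (cong (-1ℤ ^ℤ_) (sum-++0 x)) (V-ignoresFinalZero x)

sum-VI² : ∀ n → sumℤ (map (VI² (suc (suc n))) (partitions (suc (suc n)))) ≡ 0ℤ
sum-VI² n = begin
  sumℤ (map (VI² m) (partitions m))
    ≡⟨ sumℤ-filter (λ x → sum x ℕ.≟ m) (VI² m) vanish (box m m) ⟩
  sumℤ (map (VI² m) (box m m))
    ≡⟨ sum-box m m (VI² m) (λ x → cong₂ (λ v i → v * (i * i)) (V-ignoresFinalZero x) (I-ignoresFinalZero m x)) ⟩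
  boxSum m m (VI² m)
    ≡⟨ boxSum-VI² n ℕ.≤-refl ℕ.≤-refl ⟩
  0ℤ ∎
  where
  open ≡-Reasoning
  m : ℕ
  m = suc (suc n)
  vanish : ∀ x → sum x ≢ m → VI² m x ≡ 0ℤ
  vanish x s≢m rewrite I-vanishes m x s≢m = ℤ.*-zeroʳ (V x)

-- Maximal packings by vertical dominoes

Cell : Set
Cell = ℕ × ℕ

down : Cell → Cell
down (i , j) = suc i , j

data Even : ℕ → Set where
  zero   : Even 0
  suc₂   : ∀ {i} → Even i → Even (suc (suc i))

Even-exclusive : ∀ {i} → Even i → Even (suc i) → ⊥
Even-exclusive (suc₂ e) (suc₂ e′) = Even-exclusive e e′

even? : ∀ i → Even i ⊎ Even (suc i)
even? zero    = inj₁ zero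
even? (suc i) = Sum.swap (Sum.map₁ suc₂ (even? i))

-- Rows are indexed from 0, so the odd rows are the second, the fourth, and so on.
oddRowsTotal : List ℕ → ℕ
oddRowsTotal []          = 0
oddRowsTotal (a ∷ [])    = 0
oddRowsTotal (a ∷ b ∷ x) = b ℕ.+ oddRowsTotal x

-- Two rows at a time: `V (a ∷ b ∷ x)` contains `σ x` twice, and only the sign of `b` remains.
V≡-1^oddRowsTotal : ∀ x → -1ℤ ^ℤ oddRowsTotal x ≡ V x
V≡-1^oddRowsTotal []          = refl
V≡-1^oddRowsTotal (a ∷ [])    = refl
V≡-1^oddRowsTotal (a ∷ b ∷ x) = begin
  -1ℤ ^ℤ (b ℕ.+ oddRowsTotal x)
    ≡⟨ ℤ.^-distribˡ-+-* -1ℤ b (oddRowsTotal x) ⟩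
  (-1ℤ ^ℤ b) * (-1ℤ ^ℤ oddRowsTotal x)
    ≡⟨ cong ((-1ℤ ^ℤ b) *_) (V≡-1^oddRowsTotal x) ⟩
  (-1ℤ ^ℤ b) * V x
    ≡⟨ σ*σ-cancel x ((-1ℤ ^ℤ b) * V x) ⟨
  (σ x * σ x) * ((-1ℤ ^ℤ b) * V x)
    ≡⟨ rearrange (σ x) (-1ℤ ^ℤ b) (V x) ⟩
  ((-1ℤ ^ℤ b) * σ x) * (σ x * V x)
    ≡⟨ cong (_* (σ x * V x)) (σ-∷ b x) ⟨
  σ (b ∷ x) * (σ x * V x) ∎
  where
  open ≡-Reasoning
  rearrange : ∀ s t v → (s * s) * (t * v) ≡ (t * s) * (s * v)
  rearrange = solve-∀

topCell : ℕ → Cell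
topCell j = 0 , j

packing : List ℕ → List Cell
packing []          = []
packing (a ∷ [])    = []
packing (a ∷ b ∷ x) = map topCell (upTo b) ++ map (down ∘ down) (packing x)

length-packing : ∀ x → length (packing x) ≡ oddRowsTotal x
length-packing []          = refl
length-packing (a ∷ [])    = refl
length-packing (a ∷ b ∷ x) = trans (List.length-++ (map topCell (upTo b)))
  (cong₂ ℕ._+_ (trans (List.length-map topCell (upTo b)) (List.length-upTo b))
               (trans (List.length-map (down ∘ down) (packing x)) (length-packing x)))

packing-even : ∀ x → All (Even ∘ proj₁) (packing x)
packing-even []          = []
packing-even (a ∷ [])    = []
packing-even (a ∷ b ∷ x) = All.++⁺ (All.map⁺ (All.universal (λ _ → zero) (upTo b)))
  (All.map⁺ (All.map suc₂ (packing-even x)))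

packing-unique : ∀ x → Unique (packing x)
packing-unique []          = []
packing-unique (a ∷ [])    = []
packing-unique (a ∷ b ∷ x) = Unique.++⁺ (Unique.map⁺ (cong proj₂) (Unique.upTo⁺ b))
  (Unique.map⁺ (λ { refl → refl }) (packing-unique x)) disjoint
  where
  disjoint : ∀ {c} → c ∈ map topCell (upTo b) × c ∈ map (down ∘ down) (packing x) → ⊥
  disjoint (c∈ , c∈′) with ∈-map⁻ topCell c∈ | ∈-map⁻ (down ∘ down) c∈′
  ... | _ , _ , refl | _ , _ , ()

packing-inShape : ∀ {n} x → Decreasing≤ n x → All (λ c → InShape x c × InShape x (down c)) (packing x)
packing-inShape []          _               = []
packing-inShape (a ∷ [])    _               = []
packing-inShape (a ∷ b ∷ x) (_ , b≤a , dx) = All.++⁺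
  (All.map⁺ (All.tabulate (λ j∈ → ℕ.<-≤-trans (∈-upTo⁻ j∈) b≤a , ∈-upTo⁻ j∈)))
  (All.map⁺ (packing-inShape x dx))

-- Lets `map down (packing x)` serve as the list of odd-row cells against which an arbitrary packing
-- is counted.
packing-covers : ∀ x i j → Even i → InShape x (suc i , j) → (suc i , j) ∈ map down (packing x)
packing-covers (a ∷ b ∷ x) .0 j zero j<b =
  ∈-map⁺ down (∈-++⁺ˡ (∈-map⁺ topCell (∈-upTo⁺ j<b)))
packing-covers (a ∷ b ∷ x) _ j (suc₂ {i} e) j< with ∈-map⁻ down (packing-covers x i j e j<)
... | _ , c∈ , refl =
  ∈-map⁺ down (∈-++⁺ʳ (map topCell (upTo b)) (∈-map⁺ (down ∘ down) c∈))
packing-covers (a ∷ []) .0 j zero ()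
packing-covers (a ∷ []) _  j (suc₂ e) ()

cellsOf-All : ∀ {P : Cell → Set} {ds} → All (λ c → P c × P (down c)) ds → All P (cellsOf ds)
cellsOf-All []             = []
cellsOf-All ((p , q) ∷ ps) = p ∷ q ∷ cellsOf-All ps

-- Tops lie in even rows and bottoms in odd rows, so only two tops or two bottoms could collide, and
-- then the dominoes coincide.
cellsOf-unique : ∀ {ds} → All (Even ∘ proj₁) ds → Unique ds → Unique (cellsOf ds)
cellsOf-unique []       []          = []
cellsOf-unique (e ∷ es) (d∉ ∷ ds!) =
  ((λ ()) ∷ cellsOf-All (All.zipWith (λ (e′ , d≢) → d≢ , λ { refl → Even-exclusive e′ e }) (es , d∉))) ∷
  cellsOf-All (All.zipWith (λ (e′ , d≢) → (λ { refl → Even-exclusive e e′ }) , λ { refl → d≢ refl }) (es , d∉)) ∷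
  cellsOf-unique es ds!

oddCell : Cell → Cell
oddCell (i , j) with even? i
... | inj₁ _ = suc i , j
... | inj₂ _ = i , j

oddCells-All : ∀ {P : Cell → Set} ds → All P (cellsOf ds) → All P (map oddCell ds)
oddCells-All []             []           = []
oddCells-All ((i , j) ∷ ds) (p ∷ q ∷ ps) with even? i
... | inj₁ _ = q ∷ oddCells-All ds ps
... | inj₂ _ = p ∷ oddCells-All ds ps

oddCells-unique : ∀ ds → Unique (cellsOf ds) → Unique (map oddCell ds)
oddCells-unique []             []                      = []
oddCells-unique ((i , j) ∷ ds) ((_ ∷ ps) ∷ qs ∷ ds!) with even? i
... | inj₁ _ = oddCells-All ds qs ∷ oddCells-unique ds ds!
... | inj₂ _ = oddCells-All ds ps ∷ oddCells-unique ds ds!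

oddCell-covered : ∀ x d → InShape x (oddCell d) → oddCell d ∈ map down (packing x)
oddCell-covered x (i , j) inside with even? i
oddCell-covered x (i , j)     inside | inj₁ e        = packing-covers x i j e inside
oddCell-covered x (suc i , j) inside | inj₂ (suc₂ e) = packing-covers x i j e inside

unique-⊆-length : ∀ {A : Set} {xs ys : List A} → Unique xs → (∀ {z} → z ∈ xs → z ∈ ys) → length xs ≤ length ys
unique-⊆-length {xs = []}     _          _   = z≤n
unique-⊆-length {xs = x ∷ xs} (x∉ ∷ xs!) sub with ∈-∃++ (sub (here refl))
... | us , vs , refl = subst (suc (length xs) ≤_) (sym (↭.↭-length (↭.shift x us vs)))
  (s≤s (unique-⊆-length xs! (λ z∈ → drop-x (All.lookup x∉ z∈) (↭.∈-resp-↭ (↭.shift x us vs) (sub (there z∈))))))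
  where
  drop-x : ∀ {z} → x ≢ z → z ∈ x ∷ us ++ vs → z ∈ us ++ vs
  drop-x x≢z (here z≡x)  = contradiction (sym z≡x) x≢z
  drop-x x≢z (there z∈) = z∈

-- Each vertical domino has exactly one cell in an odd row, and disjoint dominoes have different
-- ones.
packing-maximal : ∀ x ds → IsDominoPacking x ds → length ds ≤ oddRowsTotal x
packing-maximal x ds (inside , ds!) = begin
  length ds                    ≡⟨ List.length-map oddCell ds ⟨
  length (map oddCell ds)      ≤⟨ unique-⊆-length (oddCells-unique ds ds!) covered ⟩
  length (map down (packing x)) ≡⟨ List.length-map down (packing x) ⟩
  length (packing x)           ≡⟨ length-packing x ⟩
  oddRowsTotal x               ∎
  where
  open ℕ.≤-Reasoning
  covered : ∀ {c} → c ∈ map oddCell ds → c ∈ map down (packing x)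
  covered c∈ with ∈-map⁻ oddCell c∈
  ... | d , d∈ , refl = oddCell-covered x d (All.lookup (oddCells-All ds inside) c∈)

maxDominoes≡oddRowsTotal : ∀ {n v} x → Decreasing≤ n x → IsMaxVerticalDominoes x v → v ≡ oddRowsTotal x
maxDominoes≡oddRowsTotal x dx ((ds , packs , refl) , max) = ℕ.≤-antisym (packing-maximal x ds packs)
  (subst (_≤ length ds) (length-packing x) (max (packing x)
    (cellsOf-All (packing-inShape x dx) , cellsOf-unique (packing-even x) (packing-unique x))))

theorem3p6 : (n : ℕ) → 2 ≤ n →
    (shapes : List (List ℕ)) → Enumerates (IsPartition n) shapes →
    (syt : List ℕ → List Tableau) →
    (∀ λs → IsPartition n λs → Enumerates (IsSYT λs) (syt λs)) →
    (v : List ℕ → ℕ) →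
    (∀ λs → IsPartition n λs → IsMaxVerticalDominoes λs (v λs)) →
    sumℤ (map (λ λs → (-1ℤ ^ℤ v λs) * (sumℤ (map sgnT (syt λs)) ^ℤ 2)) shapes)
    ≡ 0ℤ
theorem3p6 n@(suc (suc k)) (s≤s (s≤s z≤n)) shapes shapes-enum syt syt-enum v v-max = begin
  sumℤ (map (λ λs → (-1ℤ ^ℤ v λs) * (sumℤ (map sgnT (syt λs)) ^ℤ 2)) shapes)
    ≡⟨ cong sumℤ (List.map-cong-local (All.tabulate
         (λ {x} x∈ → term x (Equivalence.to (proj₂ shapes-enum x) x∈)))) ⟩
  sumℤ (map (VI² n) shapes)
    ≡⟨ sum-enumeration (VI² n) shapes-enum (partitions-enumerates n) ⟩
  sumℤ (map (VI² n) (partitions n))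
    ≡⟨ sum-VI² k ⟩
  0ℤ ∎
  where
  open ≡-Reasoning
  term : ∀ x → IsPartition n x → (-1ℤ ^ℤ v x) * (sumℤ (map sgnT (syt x)) ^ℤ 2) ≡ VI² n x
  term x p@(_ , _ , s≡n) = cong₂ _*_
    (trans (cong (-1ℤ ^ℤ_) (maxDominoes≡oddRowsTotal x dx (v-max x p))) (V≡-1^oddRowsTotal x))
    (trans (cong (_^ℤ 2) (trans
             (sum-enumeration sgnT (syt-enum x p) (tableaux-enumerates n x dx s≡n))
             (imbalance n x dx s≡n)))
           -- `z ^ℤ 2` unfolds to `z * (z * 1ℤ)`.
           (cong (I n x *_) (ℤ.*-identityʳ (I n x))))
    where
    dx : Decreasing≤ n x
    dx = partition-Decreasing≤ p
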